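{- Let $n\in\mathbb{N}_0$ with $n\ge 2$. Then the median of the Sierpiński triangle graph $\widehat{S}^n_3$ is $$M(\widehat{S}^n_3)=\{0,1,2,00,11,22\},$$ so that $|M(\widehat{S}^n_3)|=6$. Moreover, the median vertices of $\widehat{S}^n_3$ are exactly the vertices formed by contracting those non-clique edges of the Sierpiński graph $S^{n+1}_3$ both of whose end vertices belong to the median $M(S^{n+1}_3)$ of $S^{n+1}_3$.
   Context: For a finite connected simple graph $G$ with distance $d$, the median $M(G)$ is the set of vertices $v$ minimizing the total distance $\sum_{u\in V(G)}d(v,u)$. Let $T=\{0,1,2\}$. For $N\in\mathbb{N}_0$ the Sierpiński graph $S^N=S^N_3$ has vertex set $T^N$ (words $s_N\ldots s_1$) and edge set $\{\{\underline{s}ij^{d-1},\underline{s}ji^{d-1}\} : \underline{s}\in T^{N-d},\ i,j\in T,\ i\neq j,\ 1\le d\le N\}=E_0^N\cup E_1^N$ (disjoint union), where $E_0^N$ consists of the edges with $d=1$ (clique edges) and $E_1^N$ of those with $d>1$ (non-clique edges). The extreme vertices are $i^N$, $i\in T$. The Sierpiński triangle graph $\widehat{S}^n=\widehat{S}^n_3$ ($n\in\mathbb{N}_0$) is obtained from $S^{n+1}$ by contracting all edges in $E_1^{n+1}$. Its vertices are labelled as follows. The edge $\{\underline{s}ij^{d-1},\underline{s}ji^{d-1}\}\in E_1^{n+1}$ (with $1<d\le n+1$, $\underline{s}\in T^{n+1-d}$, $i\ne j$) is contracted to the vertex labelled $\underline{s}k$ with $k=3-i-j$; the extreme vertex $i^{n+1}$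 of $S^{n+1}$ becomes the primitive vertex $\widehat{i}$. Thus $V(\widehat{S}^n)=\{\widehat{0},\widehat{1},\widehat{2}\}\cup\bigcup_{\ell=1}^{n}T^{\ell}$. Two distinct vertices of $\widehat{S}^n$ are adjacent iff some vertices of $S^{n+1}$ contracted to them are joined by an edge of $E_0^{n+1}$. -}

module Defs where

open import Data.Fin using (Fin; toℕ; fromℕ<)
open import Data.Fin.Properties using (toℕ<n; toℕ-injective; toℕ-fromℕ<)
open import Data.List using (List; []; _∷_; [_]; _++_; map; length; concat; allFin; cartesianProductWith)
open import Data.List.Membership.Propositional using (_∈_)
open import Data.List.Membership.Propositional.Properties
  using (∈-map⁺; ∈-map⁻; ∈-++⁺ˡ; ∈-++⁺ʳ; ∈-concat⁺′; ∈-concat⁻′; ∈-allFin; ∈-cartesianProductWith⁺)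
open import Data.List.Relation.Unary.All as All using ([]; _∷_)
import Data.List.Relation.Unary.All.Properties as All
open import Data.List.Relation.Unary.AllPairs as AllPairs using ([]; _∷_)
import Data.List.Relation.Unary.AllPairs.Properties as AllPairs
open import Data.List.Relation.Unary.Any using (here)
open import Data.List.Relation.Unary.Unique.Propositional using (Unique)
open import Data.List.Relation.Unary.Unique.Propositional.Properties
  using (map⁺; ++⁺; concat⁺; allFin⁺; cartesianProductWith⁺)
open import Data.List.Relation.Binary.Disjoint.Propositional using (Disjoint)
open import Data.Nat using (ℕ; zero; suc; _+_; _∸_; _≤_; _<_)
open import Data.Nat.ListAction using (sum)
open import Data.Nat.DivMod using (_mod_)
open import Data.Nat.Properties using (+-suc; suc-injective; m<m+n; ≤-reflexive; <-≤-trans)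
open import Data.Product using (Σ; ∃-syntax; _×_; _,_)
open import Data.Vec as Vec using (Vec; []; _∷_; _∷ʳ_; replicate; cast)
open import Data.Vec.Properties using (cast-is-id; ++-injectiveʳ; ∷-injective; ∷-injectiveˡ)
open import Function using (_∘_)
open import Level using (0ℓ)
open import Relation.Binary.PropositionalEquality using (_≡_; _≢_; refl; sym; trans)
open import Relation.Nullary using (¬_)
open import Relation.Unary using (Pred; _≐_)

record FiniteSimpleGraph : Set₁ where
  infix 4 _~_
  field
    Vertex   : Set
    _~_      : Vertex → Vertex → Set
    ~-irrefl : ∀ {v} → ¬ (v ~ v)
    ~-sym    : ∀ {u v} → u ~ v → v ~ u
    vertices : List Vertex
    complete : ∀ v → v ∈ vertices
    unique   : Unique vertices

module _ (G : FiniteSimpleGraph) where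
  open FiniteSimpleGraph G

  data Walk : Vertex → Vertex → ℕ → Set where
    nil  : ∀ {v} → Walk v v 0
    cons : ∀ {u v w k} → u ~ v → Walk v w k → Walk u w (suc k)

  IsDistance : (Vertex → Vertex → ℕ) → Set
  IsDistance d = ∀ u v → Walk u v (d u v) × (∀ {k} → Walk u v k → d u v ≤ k)

  totalDistance : (Vertex → Vertex → ℕ) → Vertex → ℕ
  totalDistance d v = sum (map (d v) vertices)

  -- A distance function is pointwise unique, and it exists only if the graph
  -- is connected; so membership in the median entails connectedness.
  Median : Pred Vertex 0ℓ
  Median v = ∃[ d ] IsDistance d × (∀ w → totalDistance d v ≤ totalDistance d w)

HasCardinality : {A : Set} → Pred A 0ℓ → ℕ → Set
HasCardinality P k = ∃[ xs ] Unique xs × length xs ≡ k × P ≐ (_∈ xs)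

T : Set
T = Fin 3

-- The word s_N … s_1, with s_N at the head.
Word : ℕ → Set
Word = Vec T

-- The oriented edge from s i j^{d-1} to s j i^{d-1}, where d = suc e;
-- the bounds 1 ≤ d ≤ N follow from |s| + d ≡ N.
record Edge {N : ℕ} (x y : Word N) : Set where
  constructor edge
  field
    {m}    : ℕ
    e      : ℕ
    s      : Word m
    i j    : T
    i≢j    : i ≢ j
    length-≡ : m + suc e ≡ N
    source : x ≡ cast length-≡ (s Vec.++ i ∷ replicate e j)
    target : y ≡ cast length-≡ (s Vec.++ j ∷ replicate e i)

IsClique : ∀ {N} {x y : Word N} → Edge x y → Set
IsClique E = Edge.e E ≡ 0

IsNonClique : ∀ {N} {x y : Word N} → Edge x y → Set
IsNonClique E = 0 < Edge.e E

CliqueEdge : ∀ {N} → Word N → Word N → Set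
CliqueEdge x y = Σ (Edge x y) IsClique

Edge-sym : ∀ {N} {x y : Word N} → Edge x y → Edge y x
Edge-sym (edge e s i j i≢j p q r) = edge e s j i (i≢j ∘ sym) p r q

Edge-irrefl : ∀ {N} {x : Word N} → ¬ Edge x x
Edge-irrefl (edge e s i j i≢j refl q r) =
  i≢j (∷-injectiveˡ (++-injectiveʳ s s
    (trans (sym (cast-is-id refl _)) (trans (trans (sym q) r) (cast-is-id refl _)))))

words : ∀ N → List (Word N)
words zero    = [ [] ]
words (suc N) = cartesianProductWith _∷_ (allFin 3) (words N)

words-complete : ∀ {N} (w : Word N) → w ∈ words N
words-complete []      = here refl
words-complete (a ∷ w) = ∈-cartesianProductWith⁺ _∷_ (∈-allFin a) (words-complete w)

words-unique : ∀ N → Unique (words N)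
words-unique zero    = [] ∷ []
words-unique (suc N) = cartesianProductWith⁺ _∷_ ∷-injective (allFin⁺ 3) (words-unique N)

S : ℕ → FiniteSimpleGraph
S N = record
  { Vertex   = Word N
  ; _~_      = Edge
  ; ~-irrefl = Edge-irrefl
  ; ~-sym    = Edge-sym
  ; vertices = words N
  ; complete = words-complete
  ; unique   = words-unique N
  }

-- Words of length suc l with l < n, i.e. of length between 1 and n.
data Label (n : ℕ) : Set where
  prim : T → Label n
  word : ∀ {l} → .(l < n) → Word (suc l) → Label n

-- For i ≢ j this is 3 - i - j; the reduction mod 3 is then vacuous.
third : T → T → T
third i j = (3 ∸ toℕ i ∸ toℕ j) mod 3

prefix-< : ∀ {m e n} → m + suc e ≡ suc n → 0 < e → m < n
prefix-< {m} {e} p 0<e =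
  <-≤-trans (m<m+n m 0<e) (≤-reflexive (suc-injective (trans (sym (+-suc m e)) p)))

contract : ∀ {n} {x y : Word (suc n)} (E : Edge x y) → IsNonClique E → Label n
contract E nc = word (prefix-< length-≡ nc) (s ∷ʳ third i j)
  where open Edge E

-- Edges are oriented, so the other end of E is covered by Edge-sym E,
-- which has the same label.
data _ContractsTo_ {n} : Word (suc n) → Label n → Set where
  extreme : ∀ i → replicate (suc n) i ContractsTo prim i
  glued   : ∀ {x y} (E : Edge x y) (nc : IsNonClique E) → x ContractsTo contract E nc

Adjacent : ∀ {n} → Label n → Label n → Set
Adjacent u v = u ≢ v ×
  ∃[ x ] ∃[ y ] x ContractsTo u × y ContractsTo v × CliqueEdge x y

Adjacent-sym : ∀ {n} {u v : Label n} → Adjacent u v → Adjacent v u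
Adjacent-sym (u≢v , x , y , p , q , E , c) = u≢v ∘ sym , y , x , q , p , Edge-sym E , c

wordLabels : ∀ {n} → Fin n → List (Label n)
wordLabels l = map (word (toℕ<n l)) (words (suc (toℕ l)))

labels : ∀ n → List (Label n)
labels n = map prim (allFin 3) ++ concat (map wordLabels (allFin n))

prim-injective : ∀ {n i j} → prim {n} i ≡ prim j → i ≡ j
prim-injective refl = refl

word-injective : ∀ {n l} .{p q : l < n} {v w : Word (suc l)} → word p v ≡ word q w → v ≡ w
word-injective refl = refl

∈-wordLabels : ∀ {n l} .(l<n : l < n) (w : Word (suc l)) (k : Fin n) → toℕ k ≡ l →
               word l<n w ∈ wordLabels k
∈-wordLabels l<n w k refl = ∈-map⁺ (word (toℕ<n k)) (words-complete w)

labels-complete : ∀ {n} (v : Label n) → v ∈ labels n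
labels-complete {n} (prim i)     = ∈-++⁺ˡ (∈-map⁺ prim (∈-allFin i))
labels-complete {n} (word l<n w) =
  ∈-++⁺ʳ (map prim (allFin 3))
    (∈-concat⁺′ (∈-wordLabels l<n w (fromℕ< l<n) (toℕ-fromℕ< l<n))
                (∈-map⁺ wordLabels (∈-allFin (fromℕ< l<n))))

wordLabels-disjoint : ∀ {n} {k l : Fin n} → k ≢ l → Disjoint (wordLabels k) (wordLabels l)
wordLabels-disjoint {k = k} {l} k≢l (p , q)
  with v , _ , refl ← ∈-map⁻ (word (toℕ<n k)) p
  with w , _ , eq ← ∈-map⁻ (word (toℕ<n l)) q = k≢l (toℕ-injective (index-≡ eq))
  where
  index-≡ : ∀ {n a b} .{p : a < n} .{q : b < n} {v : Word (suc a)} {w : Word (suc b)} →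
            word p v ≡ word q w → a ≡ b
  index-≡ refl = refl

prim-disjoint : ∀ {n} → Disjoint (map prim (allFin 3)) (concat (map wordLabels (allFin n)))
prim-disjoint {n} (p , q)
  with i , _ , refl ← ∈-map⁻ prim p
  with xs , prim∈xs , xs∈ ← ∈-concat⁻′ (map wordLabels (allFin n)) q
  with l , _ , refl ← ∈-map⁻ wordLabels xs∈
  with w , _ , () ← ∈-map⁻ (word (toℕ<n l)) prim∈xs

labels-unique : ∀ n → Unique (labels n)
labels-unique n = ++⁺ (map⁺ prim-injective (allFin⁺ 3))
  (concat⁺
    (All.map⁺ (All.universal (λ l → map⁺ word-injective (words-unique (suc (toℕ l)))) (allFin n)))
    (AllPairs.map⁺ (AllPairs.map wordLabels-disjoint (allFin⁺ n))))
  prim-disjoint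

Ŝ : ℕ → FiniteSimpleGraph
Ŝ n = record
  { Vertex   = Label n
  ; _~_      = Adjacent
  ; ~-irrefl = λ (v≢v , _) → v≢v refl
  ; ~-sym    = Adjacent-sym
  ; vertices = labels n
  ; complete = labels-complete
  ; unique   = labels-unique n
  }

{-# OPTIONS --safe #-}
module Submission where

-- Give the clique edges of the Sierpiński graph length 1 and the other edges length ω. For ω = 1
-- the distances are those of S, for ω = 0 they are those of Ŝ pulled back to words. The distances
-- of a word of length n to the three extreme vertices always add up to twice the side length L n;
-- summed over the vertices of Ŝ, the total distance of a vertex is therefore half the total
-- distance of a word over it, up to a constant, and both graphs can be treated at once.
-- The shortest path between words with different first letters i and j either crosses the edge
-- between the two parts or makes a detour through the third part. Hence, up to a correction κ for
-- the detours, the total distance of i w is that of w plus a multiple of the distances from w to the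
-- two corners where its part is attached. Unfolding this twice, the total distance of i j v becomes
-- a function of the total distance and the corner distances of v. It takes the same value at the
-- corners v = j … j and v = k … k (with k the third letter) and a larger one elsewhere: near either
-- of these corners by convexity of κ, far from them by crude linear bounds. So the minimizers are
-- the words i j j … j and i j k … k, which are the ends of the non-clique edges contracted to the
-- vertices k and i i.

open import Defs
open import Data.Fin using (Fin; toℕ; zero; suc; _≟_)
open import Data.Fin.Patterns using (0F; 1F; 2F)
open import Data.Fin.Properties using (all?; toℕ<n)
open import Data.List as List using (List; []; _∷_; map; allFin; concat; tabulate; _++_)
open import Data.List using () renaming ([] to []ₗ; _∷_ to _∷ₗ_)
open import Data.List.Membership.Propositional using (_∈_)
open import Data.List.Properties using (map-++; map-∘; map-cong; map-tabulate; tabulate-cong)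
open import Data.List.Relation.Unary.All using ([]; _∷_)
open import Data.List.Relation.Unary.AllPairs using ([]; _∷_)
open import Data.List.Relation.Unary.Any using (here; there)
open import Data.Nat hiding (_≟_)
import Data.Nat as ℕ
open import Data.Nat.ListAction using (sum)
open import Data.Nat.ListAction.Properties using (sum-++)
open import Data.Nat.Properties hiding (_≟_)
open import Data.Nat.Tactic.RingSolver using (solve; solve-∀)
open import Data.Product using (_×_; _,_; ∃-syntax; proj₁; proj₂)
open import Data.Sum using (_⊎_; inj₁; inj₂; [_,_]′)
open import Data.Vec as Vec using ([]; _∷_; _∷ʳ_; replicate; cast)
open import Data.Vec.Properties using (cast-is-id)
open import Function using (_∘_)
open import Relation.Binary.PropositionalEquality
open import Relation.Nullary using (yes; no; contradiction; ¬?)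
open import Relation.Nullary.Decidable using (from-yes; _→-dec_)
open import Relation.Unary using (_≐_)

-- Linear certificates and convexity of truncated subtraction.

-- Format for linear arithmetic: the hypotheses, taken with suitable multipliers, are added up to
-- `p ≤ q`, `s` is the slack left over, and the remaining identity is left to the ring solver.
by-slack : ∀ {p q x y} s → p ≤ q → x + q + s ≡ p + y → x ≤ y
by-slack {p} {q} {x} {y} s p≤q eq = +-cancelˡ-≤ q x y (begin
  q + x     ≡⟨ +-comm q x ⟩
  x + q     ≤⟨ m≤m+n (x + q) s ⟩
  x + q + s ≡⟨ eq ⟩
  p + y     ≤⟨ +-monoˡ-≤ y p≤q ⟩
  q + y     ∎)
  where open ≤-Reasoning

infixl 5 _⊕_
infixr 6 _⊛_

_⊕_ : ∀ {a b c d} → a ≤ b → c ≤ d → a + c ≤ b + d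
_⊕_ = +-mono-≤

_⊛_ : ∀ {a b} k → a ≤ b → k * a ≤ k * b
k ⊛ h = *-monoʳ-≤ k h

∸-superadditive : ∀ x y s → (x ∸ s) + (y ∸ s) ≤ (x + y) ∸ s
∸-superadditive x y s with ≤-total s x
... | inj₁ s≤x = begin
  (x ∸ s) + (y ∸ s) ≤⟨ +-monoʳ-≤ (x ∸ s) (m∸n≤m y s) ⟩
  (x ∸ s) + y       ≡⟨ +-∸-comm y s≤x ⟨
  (x + y) ∸ s       ∎
  where open ≤-Reasoning
... | inj₂ x≤s rewrite m≤n⇒m∸n≡0 x≤s = ∸-monoˡ-≤ s (m≤n+m y x)

-- Convexity of truncated subtraction in its first argument: the increment over a step y does not
-- shrink when the starting point moves from p to p + x.
∸-convex : ∀ p x y q → ((p + x) ∸ q) + ((p + y) ∸ q) ≤ (p ∸ q) + ((p + x + y) ∸ q)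
∸-convex zero    x y q       = ≤-trans (∸-superadditive x y q) (m≤n+m _ (0 ∸ q))
∸-convex (suc p) x y (suc q) = ∸-convex p x y q
∸-convex (suc p) x y zero    = ≤-reflexive (rearrange p x y)
  where
  rearrange : ∀ p x y → (suc p + x) + (suc p + y) ≡ suc p + (suc p + x + y)
  rearrange = solve-∀

-- Side lengths and the detour correction κ.

module Weights (ω : ℕ) where

  -- The length of an edge between s i jⁿ and s j iⁿ.
  link : ℕ → ℕ
  link zero    = 1
  link (suc _) = ω

  -- The distance between two extreme vertices of words of length n.
  L : ℕ → ℕ
  L zero    = 0
  L (suc n) = L n + (L n + link n)

  -- A side together with the edge leading out of it: a word of length n gets this much farther from
  -- the extreme vertex of i when a letter other than i is put in front.
  M : ℕ → ℕ
  M n = L n + link n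

  L≤M : ∀ n → L n ≤ M n
  L≤M n = m≤m+n (L n) (link n)

  M>0 : ∀ n → 0 < M n
  M>0 zero    = s≤s z≤n
  M>0 (suc n) = ≤-trans (M>0 n) (≤-trans (m≤n+m (M n) (L n)) (m≤m+n (L (suc n)) ω))

  M-suc-suc : ∀ m → M (suc (suc m)) ≡ M (suc m) + M (suc m)
  M-suc-suc m = rearrange (L (suc m)) ω
    where
    rearrange : ∀ l w → l + (l + w) + w ≡ (l + w) + (l + w)
    rearrange = solve-∀

  -- κ n p q is the sum of (d(x, u) + p) ∸ (d(z, u) + q) over all words u of length n,
  -- for any two extreme vertices x ≢ z.
  κ : ℕ → ℕ → ℕ → ℕ
  κ zero    p q = p ∸ q
  κ (suc n) p q = κ n p (q + M n) + κ n p q + κ n (p + M n) q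

  private
    swap : ∀ p x y → p + x + y ≡ p + y + x
    swap = solve-∀

  κ-shift : ∀ n x {p q} → κ n (p + x) (q + x) ≡ κ n p q
  κ-shift zero x {p} {q} rewrite +-comm p x | +-comm q x = [m+n]∸[m+o]≡n∸o x p q
  κ-shift (suc n) x {p} {q} rewrite swap p x (M n) | swap q x (M n) =
    cong₂ _+_ (cong₂ _+_ (κ-shift n x) (κ-shift n x)) (κ-shift n x)

  κ-mono : ∀ n {p p′ q q′} → p ≤ p′ → q′ ≤ q → κ n p q ≤ κ n p′ q′
  κ-mono zero    h k = ∸-mono h k
  κ-mono (suc n) h k =
    κ-mono n h (+-monoˡ-≤ (M n) k) ⊕ κ-mono n h k ⊕ κ-mono n (+-monoˡ-≤ (M n) h) k

  -- No distance to an extreme vertex exceeds `L n`, so every term of the sum is truncated to 0.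
  κ-zero : ∀ n {p q} → p + L n ≤ q → κ n p q ≡ 0
  κ-zero zero    {p} {q} h = m≤n⇒m∸n≡0 (subst (_≤ q) (+-identityʳ p) h)
  κ-zero (suc n) {p} {q} h =
    cong₂ _+_ (cong₂ _+_ (κ-zero n (≤-trans p+L≤q (m≤m+n q (M n)))) (κ-zero n p+L≤q))
              (κ-zero n (≤-trans (≤-reflexive (rearrange p (L n) (M n))) h))
    where
    rearrange : ∀ p l m → p + m + l ≡ p + (l + m)
    rearrange = solve-∀
    p+L≤q : p + L n ≤ q
    p+L≤q = ≤-trans (+-monoʳ-≤ p (m≤m+n (L n) (M n))) h

  -- Summed form of (a ∸ b) + b ≡ (b ∸ a) + a. The distances to two extreme vertices have the same
  -- total and cancel, so only p and q, times the number of words, remain.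
  κ-flip : ∀ n p q → κ n p q + q * 3 ^ n ≡ κ n q p + p * 3 ^ n
  κ-flip zero p q rewrite *-identityʳ p | *-identityʳ q = begin
    (p ∸ q) + q ≡⟨ +-comm (p ∸ q) q ⟩
    q + (p ∸ q) ≡⟨ m+n∸m≡m+n∸m q p ⟩
    p + (q ∸ p) ≡⟨ +-comm p (q ∸ p) ⟩
    (q ∸ p) + p ∎
    where
    open ≡-Reasoning
    m+n∸m≡m+n∸m : ∀ q p → q + (p ∸ q) ≡ p + (q ∸ p)
    m+n∸m≡m+n∸m zero    zero    = refl
    m+n∸m≡m+n∸m zero    (suc p) = sym (+-identityʳ (suc p))
    m+n∸m≡m+n∸m (suc q) zero    = +-identityʳ (suc q)
    m+n∸m≡m+n∸m (suc q) (suc p) = cong suc (m+n∸m≡m+n∸m q p)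
  κ-flip (suc n) p q =
    combine p q (M n) (3 ^ n) (κ-flip n p (q + M n)) (κ-flip n p q) (κ-flip n (p + M n) q)
    where
    combine : ∀ p q m N {a b c a′ b′ c′} →
      a + (q + m) * N ≡ c′ + p * N → b + q * N ≡ b′ + p * N → c + q * N ≡ a′ + (p + m) * N →
      a + b + c + q * (3 * N) ≡ a′ + b′ + c′ + p * (3 * N)
    combine p q m N {a} {b} {c} {a′} {b′} {c′} h k l = ≤-antisym
      (by-slack 0 (≤-reflexive h ⊕ ≤-reflexive k ⊕ ≤-reflexive l)
        (solve (p ∷ₗ q ∷ₗ m ∷ₗ N ∷ₗ a ∷ₗ b ∷ₗ c ∷ₗ a′ ∷ₗ b′ ∷ₗ c′ ∷ₗ []ₗ)))
      (by-slack 0 (≤-reflexive (sym h) ⊕ ≤-reflexive (sym k) ⊕ ≤-reflexive (sym l))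
        (solve (p ∷ₗ q ∷ₗ m ∷ₗ N ∷ₗ a ∷ₗ b ∷ₗ c ∷ₗ a′ ∷ₗ b′ ∷ₗ c′ ∷ₗ []ₗ)))

  κ-convex : ∀ n p x y q → κ n (p + x) q + κ n (p + y) q ≤ κ n p q + κ n (p + x + y) q
  κ-convex zero    p x y q = ∸-convex p x y q
  κ-convex (suc n) p x y q
    rewrite swap p y (M n) | swap (p + x) y (M n) | swap p x (M n) =
    subst₂ _≤_ (interchange (f (p + x)) (g (p + x)) (g (p + M n + x)) _ _ _)
               (interchange (f p) (g p) (g (p + M n)) _ _ _)
      (κ-convex n p x y (q + M n) ⊕ κ-convex n p x y q ⊕ κ-convex n (p + M n) x y q)
    where
    f g : ℕ → ℕ
    f r = κ n r (q + M n)
    g r = κ n r q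
    interchange : ∀ a b c a′ b′ c′ →
      a + a′ + (b + b′) + (c + c′) ≡ a + b + c + (a′ + b′ + c′)
    interchange = solve-∀

  -- For x up to a smaller side, only the part at z, the extreme vertex whose distance is
  -- subtracted, has positive terms. Beyond that, in `κ-suc-large`, the third part joins in.
  κ-suc-small : ∀ n {x} → x ≤ L n → κ (suc n) x (L (suc n)) ≡ κ n x (L n)
  κ-suc-small n {x} x≤L
    rewrite κ-zero n {x} {L (suc n) + M n}
              (≤-trans (+-mono-≤ x≤L (L≤M n)) (m≤m+n (L n + M n) (M n)))
          | κ-zero n {x} {L (suc n)} (+-mono-≤ x≤L (L≤M n)) = κ-shift n (M n)

  κ-suc-large : ∀ n {x} → x ≤ M n → κ (suc n) (L n + x) (L (suc n)) ≡ κ n x (M n) + κ n x 0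
  κ-suc-large n {x} x≤M = begin
    κ n (L n + x) (L n + M n + M n) + κ n (L n + x) (L n + M n) + κ n (L n + x + M n) (L n + M n)
      ≡⟨ cong₂ _+_ (cong₂ _+_ (κ-zero n high) (cong₂ (κ n) (+-comm (L n) x) (+-comm (L n) (M n))))
                   (cong (λ p → κ n p (L n + M n)) (rearrange (L n) x (M n))) ⟩
    κ n (x + L n) (M n + L n) + κ n (x + (L n + M n)) (0 + (L n + M n))
      ≡⟨ cong₂ _+_ (κ-shift n (L n)) (κ-shift n (L n + M n)) ⟩
    κ n x (M n) + κ n x 0 ∎
    where
    open ≡-Reasoning
    rearrange : ∀ l x m → l + x + m ≡ x + (l + m)
    rearrange = solve-∀
    high : L n + x + L n ≤ L n + M n + M n
    high = +-mono-≤ (+-monoʳ-≤ (L n) x≤M) (L≤M n)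

  private
    bound-large : ∀ {a b c l x N} → 3 * a ≤ l * N → 3 * b ≤ l * N → c + 0 ≡ b + x * N →
                  3 * (a + c) ≤ (l + x) * (3 * N)
    bound-large {a} {b} {c} {l} {x} {N} h k e =
      by-slack (l * N) (h ⊕ k ⊕ 3 ⊛ ≤-reflexive e) (solve (a ∷ₗ b ∷ₗ c ∷ₗ l ∷ₗ x ∷ₗ N ∷ₗ []ₗ))

  -- In the limit the sharp constant is 5 instead of 3, but it fails for small n.
  κ-linear : ∀ n {x} → x ≤ L n → 3 * κ n x (L n) ≤ x * 3 ^ n
  κ-linear zero    {.0} z≤n = z≤n
  κ-linear (suc n) {x}  x≤L with ≤-total x (L n)
  ... | inj₁ x≤L′ rewrite κ-suc-small n x≤L′ =
    ≤-trans (κ-linear n x≤L′) (*-monoʳ-≤ x (m≤m+n (3 ^ n) _))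
  ... | inj₂ L′≤x with m≤n⇒∃[o]m+o≡n L′≤x
  ...   | y , refl rewrite κ-suc-large n (+-cancelˡ-≤ (L n) _ _ x≤L) =
    bound-large {κ n y (M n)} {κ n 0 y} {κ n y 0} {L n} {y} {3 ^ n}
      (bound (κ-mono n (+-cancelˡ-≤ (L n) y (M n) x≤L) ≤-refl) (κ-shift n (M n) {0} {0}))
      (bound (κ-mono n ≤-refl z≤n) refl)
      (κ-flip n y 0)
    where
    bound : ∀ {k k′} → k ≤ k′ → k′ ≡ κ n 0 0 → 3 * k ≤ L n * 3 ^ n
    bound h refl =
      ≤-trans (3 ⊛ ≤-trans h (≤-reflexive (sym (κ-shift n (L n) {0} {0})))) (κ-linear n ≤-refl)

  κ-linear-M : ∀ n {x} → x ≤ L n → 3 * κ n x (M n) ≤ x * 3 ^ n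
  κ-linear-M n x≤L = ≤-trans (3 ⊛ κ-mono n ≤-refl (L≤M n)) (κ-linear n x≤L)

  -- Only the summand whose first argument is the larger of a and b can be nonzero, and the
  -- difference of a and b is at most c.
  κ-pair : ∀ n {a b c} → a ≤ c + b → b ≤ c + a → κ n a (b + M n) + κ n b (a + M n) ≤ κ n c (M n)
  κ-pair n {a} {b} {c} a≤c+b b≤c+a with ≤-total a b
  ... | inj₁ a≤b rewrite κ-zero n (+-mono-≤ a≤b (L≤M n)) = begin
    κ n b (a + M n)       ≤⟨ κ-mono n b≤c+a (≤-reflexive (+-comm (M n) a)) ⟩
    κ n (c + a) (M n + a) ≡⟨ κ-shift n a ⟩
    κ n c (M n)           ∎
    where open ≤-Reasoning
  ... | inj₂ b≤a rewrite κ-zero n (+-mono-≤ b≤a (L≤M n)) | +-identityʳ (κ n a (b + M n)) = begin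
    κ n a (b + M n)       ≤⟨ κ-mono n a≤c+b (≤-reflexive (+-comm (M n) b)) ⟩
    κ n (c + b) (M n + b) ≡⟨ κ-shift n b ⟩
    κ n c (M n)           ∎
    where open ≤-Reasoning

-- Estimates of κ near the optimal corners and far from them.

private
  nearʲ-arith : ∀ {r₁ r₂ x y z N b t} →
    r₂ + b * N ≡ y + (b + t) * N → x + y ≤ z → r₁ ≡ x →
    (r₁ + r₂) + N * b ≤ z + N * (b + t)
  nearʲ-arith {r₁} {r₂} {x} {y} {z} {N} {b} {t} h k e =
    by-slack 0 (≤-reflexive h ⊕ k ⊕ ≤-reflexive e)
      (solve (r₁ ∷ₗ r₂ ∷ₗ x ∷ₗ y ∷ₗ z ∷ₗ N ∷ₗ b ∷ₗ t ∷ₗ []ₗ))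

module κ-Bounds (ω : ℕ) where
  open Weights ω

  -- Convexity starting at `link n`, where the correction against `M n` still vanishes: `κ n 0 t` is
  -- the correction of M n - t against `M n`, and t and M n - t add up to `link n` plus `L n`.
  κ-split : ∀ n {t} → link n ≤ t → t ≤ L n → κ n t (M n) + κ n 0 t ≤ κ n (L n) (M n)
  κ-split n {t} link≤t t≤L
    with x , refl ← m≤n⇒∃[o]m+o≡n link≤t
    with y , eq ← m≤n⇒∃[o]m+o≡n t≤L = begin
    κ n t (M n) + κ n 0 t
      ≡⟨ cong (κ n t (M n) +_) (trans (sym (κ-shift n (k + y))) (cong (κ n (k + y)) t+k+y)) ⟩
    κ n t (M n) + κ n (k + y) (M n)
      ≤⟨ κ-convex n k x y (M n) ⟩
    κ n k (M n) + κ n (t + y) (M n)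
      ≡⟨ cong₂ _+_ (κ-zero n (≤-reflexive (+-comm k (L n)))) (cong (λ p → κ n p (M n)) eq) ⟩
    κ n (L n) (M n) ∎
    where
    open ≤-Reasoning
    k = link n
    t+k+y : t + (k + y) ≡ M n
    t+k+y = trans (shunt t k y) (cong (_+ k) eq)
      where
      shunt : ∀ t k y → t + (k + y) ≡ t + y + k
      shunt = solve-∀

  -- With t = c - b, `κ-flip` turns `κ n c b` into `κ n 0 t` plus t * 3 ^ n, and `κ-split` bounds
  -- what remains.
  κ-nearʲ : ∀ n {b c} → b + link n ≤ c → c ≤ b + L n →
    (κ n c (b + M n) + κ n c b) + 3 ^ n * b ≤ κ n (L n) (M n) + 3 ^ n * c
  κ-nearʲ n {b} {c} b+link≤c c≤b+L
    with t , refl ← m≤n⇒∃[o]m+o≡n (≤-trans (m≤m+n b (link n)) b+link≤c) =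
    nearʲ-arith {x = κ n t (M n)} {y = κ n 0 t} {b = b}
      (trans (κ-flip n (b + t) b) (cong (_+ (b + t) * 3 ^ n) κ-b))
      (κ-split n (+-cancelˡ-≤ b _ _ b+link≤c) (+-cancelˡ-≤ b _ _ c≤b+L))
      (trans (cong₂ (κ n) (+-comm b t) (+-comm b (M n))) (κ-shift n b))
    where
    κ-b : κ n b (b + t) ≡ κ n 0 t
    κ-b = trans (cong (κ n b) (+-comm b t)) (κ-shift n b)

  κ-linear-shift : ∀ n {a c} → a ≤ c → c ≤ a + L n →
    3 * κ n c (a + M n) + 3 ^ n * a ≤ 3 ^ n * c
  κ-linear-shift n {a} {c} a≤c c≤a+L with t , refl ← m≤n⇒∃[o]m+o≡n a≤c
    rewrite +-comm a t | +-comm a (M n) | κ-shift n a {t} {M n} =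
    by-slack 0 (κ-linear-M n (+-cancelʳ-≤ a t (L n) (≤-trans c≤a+L (≤-reflexive (+-comm a (L n))))))
      (rearrange (κ n t (M n)) (3 ^ n) a t)
    where
    rearrange : ∀ k N a t → 3 * k + N * a + t * N + 0 ≡ 3 * k + N * (t + a)
    rearrange = solve-∀

  private
    κ-0≤ : ∀ n {x} → 3 * κ n 0 x ≤ L n * 3 ^ n
    κ-0≤ n = ≤-trans (3 ⊛ ≤-trans (κ-mono n ≤-refl z≤n) (≤-reflexive (sym (κ-shift n (L n)))))
                     (κ-linear n ≤-refl)

    far-arith₁ : ∀ {r₁ r₂ s N c l} → r₁ ≡ 0 → r₂ ≤ s → 3 * s ≤ l * N →
      3 * (r₁ + r₂) + 4 * (N * c) ≤ N * l + 4 * (N * c)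
    far-arith₁ {r₁} {r₂} {s} {N} {c} {l} e h k =
      by-slack 0 (3 ⊛ ≤-reflexive e ⊕ 3 ⊛ h ⊕ k) (solve (r₁ ∷ₗ r₂ ∷ₗ s ∷ₗ N ∷ₗ c ∷ₗ l ∷ₗ []ₗ))

    far-arith₂ : ∀ {r₁ r₂ s N b t l} → 3 * r₁ ≤ t * N → r₂ + 0 ≡ s + t * N → 3 * s ≤ l * N →
      3 * (r₁ + r₂) + 4 * (N * b) ≤ N * l + 4 * (N * (t + b))
    far-arith₂ {r₁} {r₂} {s} {N} {b} {t} {l} e h k =
      by-slack 0 (e ⊕ 3 ⊛ ≤-reflexive h ⊕ k) (solve (r₁ ∷ₗ r₂ ∷ₗ s ∷ₗ N ∷ₗ b ∷ₗ t ∷ₗ l ∷ₗ []ₗ))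

  -- The minimum covers both orders of b and c. For c ≤ b only `κ n c b` survives and is at most
  -- `κ n 0 0`. For c = b + t the excess t is paid at rate 4: once by the linear bound on
  -- `κ n t (M n)`, three times through `κ-flip`.
  κ-far-⊓ : ∀ n {b c} → c ≤ b + L n →
    3 * (κ n c (b + M n) + κ n c b) + 4 * (3 ^ n * (b ⊓ c)) ≤ 3 ^ n * L n + 4 * (3 ^ n * c)
  κ-far-⊓ n {b} {c} c≤b+L with ≤-total c b
  ... | inj₁ c≤b rewrite m≥n⇒m⊓n≡n c≤b =
    far-arith₁ {κ n c (b + M n)} {κ n c b} {κ n 0 0} {3 ^ n} {c} {L n}
      (κ-zero n (+-mono-≤ c≤b (L≤M n)))
      (≤-trans (κ-mono n c≤b ≤-refl) (≤-reflexive (κ-shift n b)))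
      (κ-0≤ n)
  ... | inj₂ b≤c rewrite m≤n⇒m⊓n≡m b≤c with t , refl ← m≤n⇒∃[o]m+o≡n b≤c
    rewrite +-comm b t | +-comm b (M n) | κ-shift n b {t} {M n} | κ-shift n b {t} {0} =
    far-arith₂ {κ n t (M n)} {κ n t 0} {κ n 0 t} {3 ^ n} {b} {t} {L n}
      (κ-linear-M n (+-cancelʳ-≤ b t (L n) (≤-trans c≤b+L (≤-reflexive (+-comm b (L n))))))
      (κ-flip n t 0)
      (κ-0≤ n)

  private
    double-arith₁ : ∀ {k c N} → 3 * k ≤ (c + c) * N → 3 * k ≤ 4 * (c * N)
    double-arith₁ {k} {c} {N} h = by-slack (2 * (c * N)) h (solve (k ∷ₗ c ∷ₗ N ∷ₗ []ₗ))

    double-arith₂ : ∀ {k k₀ s₁ s₂ c l s N} → k ≤ s₁ → k₀ + 0 ≡ s₂ + s * N → 3 * (s₁ + s₂) ≤ l * N →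
      l + s ≡ c + c → s ≤ l → 3 * (k + k₀) ≤ 4 * (c * N)
    double-arith₂ {k} {k₀} {s₁} {s₂} {c} {l} {s} {N} h₁ h₂ h₃ h₄ h₅ =
      by-slack 0 (3 ⊛ h₁ ⊕ 3 ⊛ ≤-reflexive h₂ ⊕ h₃ ⊕ 2 * N ⊛ ≤-reflexive h₄ ⊕ N ⊛ h₅)
        (solve (k ∷ₗ k₀ ∷ₗ s₁ ∷ₗ s₂ ∷ₗ c ∷ₗ l ∷ₗ s ∷ₗ N ∷ₗ []ₗ))

  -- Applying `κ-linear` at level suc m would give the factor 6. Descending one level first, and
  -- using convexity when c + c exceeds `L m`, lowers it to 4.
  κ-double : ∀ m {c} → c ≤ L m → 3 * κ (suc m) (c + c) (L (suc m)) ≤ 4 * (c * 3 ^ m)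
  κ-double m {c} c≤l with ≤-total (c + c) (L m)
  ... | inj₁ 2c≤l rewrite κ-suc-small m 2c≤l = double-arith₁ {κ m (c + c) (L m)} {c}
    (κ-linear m 2c≤l)
  ... | inj₂ l≤2c with s , eq ← m≤n⇒∃[o]m+o≡n l≤2c rewrite sym eq =
    go (+-cancelˡ-≤ (L m) s (L m) (≤-trans (≤-reflexive eq) (+-mono-≤ c≤l c≤l)))
    where
    go : s ≤ L m → 3 * κ (suc m) (L m + s) (L (suc m)) ≤ 4 * (c * 3 ^ m)
    go s≤l with y , s+y≡l ← m≤n⇒∃[o]m+o≡n s≤l
      rewrite κ-suc-large m (≤-trans s≤l (L≤M m)) =
      double-arith₂ {κ m s (M m)} {κ m s 0} {κ m s (L m)} {κ m 0 s} {c}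
        (κ-mono m ≤-refl (L≤M m)) (κ-flip m s 0) (≤-trans (3 ⊛ convex) (κ-linear m ≤-refl))
        eq s≤l
      where
      open ≤-Reasoning
      convex : κ m s (L m) + κ m 0 s ≤ κ m (L m) (L m)
      convex = begin
        κ m s (L m) + κ m 0 s
          ≡⟨ cong (κ m s (L m) +_) (trans (sym (κ-shift m y)) (cong (κ m y) s+y≡l)) ⟩
        κ m s (L m) + κ m y (L m)
          ≤⟨ κ-convex m 0 s y (L m) ⟩
        κ m 0 (L m) + κ m (s + y) (L m)
          ≡⟨ cong₂ _+_ (κ-zero m ≤-refl) (cong (λ p → κ m p (L m)) s+y≡l) ⟩
        κ m (L m) (L m) ∎

  κ-L-expand : ∀ m → M (suc m) ≡ M m + M m → ∀ {x} →
    κ (suc m) (L (suc m)) (x + M (suc m)) ≡ κ m (L m) (x + M m) + κ m (L m) x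
  κ-L-expand m M′≡2M {x} rewrite M′≡2M = begin
    κ m (L m + M m) (x + MM + M m) + κ m (L m + M m) (x + MM) + κ m (L m + M m + M m) (x + MM)
      ≡⟨ cong₂ _+_ (cong₂ _+_ (κ-zero m high)
           (trans (cong (κ m _) (sym (+-assoc x (M m) (M m)))) (κ-shift m (M m))))
           (trans (cong (λ p → κ m p (x + MM)) (+-assoc (L m) (M m) (M m))) (κ-shift m MM)) ⟩
    κ m (L m) (x + M m) + κ m (L m) x ∎
    where
    open ≡-Reasoning
    MM = M m + M m
    rearrange : ∀ x l m → l + m + m + x ≡ x + (m + l) + m
    rearrange = solve-∀
    high : L m + M m + L m ≤ x + MM + M m
    high = ≤-trans (+-mono-≤ (+-monoˡ-≤ (M m) (L≤M m)) (L≤M m))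
                   (+-monoˡ-≤ (M m) (m≤n+m MM x))

  private
    near-arith₀ : ∀ {p q r l N} → 3 * r ≤ l * N → 3 * (p + q + r) ≤ 3 * (p + q) + l * N
    near-arith₀ {p} {q} {r} {l} {N} h = by-slack 0 h (solve (p ∷ₗ q ∷ₗ r ∷ₗ l ∷ₗ N ∷ₗ []ₗ))

    near-arith₁ : ∀ {k p q x y t c N} → 3 * k ≤ 4 * (c * N) → x + y ≤ p →
      ∀ {u} → u + 0 ≡ y + t * N → q + 0 ≡ 0 + (c + t) * N →
      3 * (k + (x + u)) ≤ 3 * (p + q) + c * N
    near-arith₁ {k} {p} {q} {x} {y} {t} {c} {N} h₁ h₂ {u} h₃ h₄ =
      by-slack 0 (h₁ ⊕ 3 ⊛ h₂ ⊕ 3 ⊛ ≤-reflexive h₃ ⊕ 3 ⊛ ≤-reflexive (sym h₄))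
        (solve (k ∷ₗ p ∷ₗ q ∷ₗ x ∷ₗ y ∷ₗ t ∷ₗ c ∷ₗ N ∷ₗ u ∷ₗ []ₗ))

  -- For c < `L m`, the first correction is at most 4/3 of c * 3 ^ m by `κ-double`, while raising
  -- the second argument of the other one from `M n` to c + `M n` lowers it by at least c * 3 ^ m.
  -- The net cost is one third.
  κ-nearᵏ : ∀ m → M (suc m) ≡ M m + M m → link m ≤ 1 → ∀ {c} → c ≤ L m → let n = suc m in
    3 * (κ n (c + c) (L n) + κ n (L n) (c + M n)) ≤ 3 * κ n (L n) (M n) + c * 3 ^ m
  κ-nearᵏ m M′≡2M link≤1 {c} c≤l
    rewrite κ-L-expand m M′≡2M {c} | κ-L-expand m M′≡2M {0}
    with t , c+t≡l ← m≤n⇒∃[o]m+o≡n c≤l with t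
  -- The case c = `L m` is computed directly, because `κ-split` below asks for link m ≤ t.
  ... | zero rewrite trans (sym (+-identityʳ c)) c+t≡l
                   | κ-suc-large m (L≤M m)
                   | κ-zero m {L m} {L m + M m} (+-monoʳ-≤ (L m) (L≤M m)) =
    near-arith₀ {κ m (L m) (M m)} {κ m (L m) 0} {κ m (L m) (L m)} {L m} (κ-linear m ≤-refl)
  ... | t@(suc _) =
    near-arith₁ {κ (suc m) (c + c) (L (suc m))} {κ m (L m) (M m)} {κ m (L m) 0}
                {κ m (L m) (c + M m)} {κ m 0 t} {t} {c} (κ-double m c≤l)
      (≤-trans (≤-reflexive (cong (_+ κ m 0 t)
                  (trans (cong₂ (κ m) l≡t+c (+-comm c (M m))) (κ-shift m c))))
        (κ-split m (≤-trans link≤1 (s≤s z≤n)) (≤-trans (m≤n+m t c) (≤-reflexive c+t≡l))))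
      (trans (cong (_+ 0) (trans (cong (λ p → κ m p c) l≡t+c) (κ-shift m c {t} {0})))
        (κ-flip m t 0))
      (trans (κ-flip m (L m) 0)
        (cong₂ (λ p q → p + q * 3 ^ m) (κ-zero m ≤-refl) (sym c+t≡l)))
    where
    l≡t+c : L m ≡ t + c
    l≡t+c = trans (sym c+t≡l) (+-comm c t)

-- The third letter, and sums over letters and words.

third-comm : ∀ i j → third i j ≡ third j i
third-comm = from-yes (all? λ i → all? λ j → third i j ≟ third j i)

third-≢ˡ : ∀ i j → i ≢ j → third i j ≢ i
third-≢ˡ = from-yes (all? λ i → all? λ j → ¬? (i ≟ j) →-dec ¬? (third i j ≟ i))

third-≢ʳ : ∀ i j → i ≢ j → third i j ≢ j
third-≢ʳ = from-yes (all? λ i → all? λ j → ¬? (i ≟ j) →-dec ¬? (third i j ≟ j))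

third-unique : ∀ i j k → i ≢ j → k ≢ i → k ≢ j → k ≡ third i j
third-unique = from-yes (all? λ i → all? λ j → all? λ k →
  ¬? (i ≟ j) →-dec ¬? (k ≟ i) →-dec ¬? (k ≟ j) →-dec (k ≟ third i j))

third-involutive : ∀ i j → i ≢ j → third i (third i j) ≡ j
third-involutive = from-yes (all? λ i → all? λ j → ¬? (i ≟ j) →-dec (third i (third i j) ≟ j))

∃≢ : ∀ (i : T) → ∃[ j ] i ≢ j
∃≢ 0F = 1F , λ ()
∃≢ 1F = 0F , λ ()
∃≢ 2F = 0F , λ ()

Σ₃ : (T → ℕ) → ℕ
Σ₃ f = f 0F + f 1F + f 2F

Σ₃-third : ∀ f {i j} → i ≢ j → Σ₃ f ≡ f i + f j + f (third i j)
Σ₃-third f {i} {j} = go i j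
  where
  f₀ = f 0F
  f₁ = f 1F
  f₂ = f 2F
  acb : ∀ a b c → a + b + c ≡ a + c + b
  acb = solve-∀
  bac : ∀ a b c → a + b + c ≡ b + a + c
  bac = solve-∀
  go : ∀ i j → i ≢ j → Σ₃ f ≡ f i + f j + f (third i j)
  go 0F 0F i≢i = contradiction refl i≢i
  go 0F 1F _   = refl
  go 0F 2F _   = acb f₀ f₁ f₂
  go 1F 0F _   = bac f₀ f₁ f₂
  go 1F 1F i≢i = contradiction refl i≢i
  go 1F 2F _   = trans (bac f₀ f₁ f₂) (acb f₁ f₀ f₂)
  go 2F 0F _   = trans (acb f₀ f₁ f₂) (bac f₀ f₂ f₁)
  go 2F 1F _   = trans (trans (acb f₀ f₁ f₂) (bac f₀ f₂ f₁)) (acb f₂ f₀ f₁)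
  go 2F 2F i≢i = contradiction refl i≢i

Σʷ : ∀ n → (Word n → ℕ) → ℕ
Σʷ zero    f = f []
Σʷ (suc n) f = Σ₃ λ i → Σʷ n (f ∘ (i ∷_))

Σʷ-cong : ∀ n {f g} → (∀ w → f w ≡ g w) → Σʷ n f ≡ Σʷ n g
Σʷ-cong zero    h = h []
Σʷ-cong (suc n) h = cong₂ _+_ (cong₂ _+_ (rec 0F) (rec 1F)) (rec 2F)
  where rec = λ i → Σʷ-cong n (λ w → h (i ∷ w))

Σʷ-mono : ∀ n {f g} → (∀ w → f w ≤ g w) → Σʷ n f ≤ Σʷ n g
Σʷ-mono zero    h = h []
Σʷ-mono (suc n) h = rec 0F ⊕ rec 1F ⊕ rec 2F
  where rec = λ i → Σʷ-mono n (λ w → h (i ∷ w))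

Σʷ-+ : ∀ n f g → Σʷ n (λ w → f w + g w) ≡ Σʷ n f + Σʷ n g
Σʷ-+ zero    f g = refl
Σʷ-+ (suc n) f g = trans (cong₂ _+_ (cong₂ _+_ (rec 0F) (rec 1F)) (rec 2F))
  (interchange (s f 0F) (s f 1F) (s f 2F) (s g 0F) (s g 1F) (s g 2F))
  where
  s : (Word (suc n) → ℕ) → T → ℕ
  s f i = Σʷ n (f ∘ (i ∷_))
  rec = λ i → Σʷ-+ n (f ∘ (i ∷_)) (g ∘ (i ∷_))
  interchange : ∀ a b c a′ b′ c′ →
    a + a′ + (b + b′) + (c + c′) ≡ a + b + c + (a′ + b′ + c′)
  interchange = solve-∀

Σʷ-const : ∀ n c → Σʷ n (λ _ → c) ≡ c * 3 ^ n
Σʷ-const zero    c = sym (*-identityʳ c)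
Σʷ-const (suc n) c rewrite Σʷ-const n c = rearrange c (3 ^ n)
  where
  rearrange : ∀ c N → c * N + c * N + c * N ≡ c * (3 * N)
  rearrange = solve-∀

-- Distances between words and their totals.

module Words (ω : ℕ) where
  open Weights ω

  -- corner i w is the distance from w to the extreme vertex iⁿ.
  corner : T → ∀ {n} → Word n → ℕ
  corner i []              = 0
  corner i {suc n} (j ∷ w) with i ≟ j
  ... | yes _ = corner i w
  ... | no  _ = corner i w + M n

  corner-≡ : ∀ i {n} (w : Word n) → corner i (i ∷ w) ≡ corner i w
  corner-≡ i w with i ≟ i
  ... | yes _   = refl
  ... | no  i≢i = contradiction refl i≢i

  corner-≢ : ∀ {i j n} (w : Word n) → i ≢ j → corner i (j ∷ w) ≡ corner i w + M n
  corner-≢ {i} {j} w i≢j with i ≟ j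
  ... | yes i≡j = contradiction i≡j i≢j
  ... | no  _   = refl

  corner-replicate-≡ : ∀ i n → corner i (replicate n i) ≡ 0
  corner-replicate-≡ i zero    = refl
  corner-replicate-≡ i (suc n) = trans (corner-≡ i (replicate n i)) (corner-replicate-≡ i n)

  corner-replicate-≢ : ∀ {i j} n → i ≢ j → corner i (replicate n j) ≡ L n
  corner-replicate-≢ zero    i≢j = refl
  corner-replicate-≢ {i} {j} (suc n) i≢j =
    trans (corner-≢ (replicate n j) i≢j) (cong (_+ M n) (corner-replicate-≢ n i≢j))

  corner≡0⇒replicate : ∀ i {n} (w : Word n) → corner i w ≡ 0 → w ≡ replicate n i
  corner≡0⇒replicate i []      _ = refl
  corner≡0⇒replicate i {suc n} (j ∷ w) h with i ≟ j
  ... | yes refl = cong (i ∷_) (corner≡0⇒replicate i w h)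
  ... | no  _    = contradiction (m+n≡0⇒n≡0 (corner i w) h) (>⇒≢ (M>0 n))

  corner≤L : ∀ i {n} (w : Word n) → corner i w ≤ L n
  corner≤L i []      = z≤n
  corner≤L i {suc n} (j ∷ w) with i ≟ j
  ... | yes _ = ≤-trans (corner≤L i w) (m≤m+n (L n) (M n))
  ... | no  _ = +-monoˡ-≤ (M n) (corner≤L i w)

  -- Prefixing a letter keeps the distance to its own extreme vertex and raises the other two by
  -- `M n`, whatever the letter.
  Σ₃-corner : ∀ {n} (w : Word n) → Σ₃ (λ i → corner i w) ≡ 2 * L n
  Σ₃-corner []      = refl
  Σ₃-corner {suc n} (h ∷ w) = trans (letter h) (trans (cong (_+ 2 * M n) (Σ₃-corner w))
                                                  (sym (*-distribˡ-+ 2 (L n) (M n))))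
    where
    letter : ∀ h → Σ₃ (λ i → corner i (h ∷ w)) ≡ Σ₃ (λ i → corner i w) + 2 * M n
    letter 0F = rearrange (corner 0F w) (corner 1F w) (corner 2F w) (M n)
      where
      rearrange : ∀ a b c m → a + (b + m) + (c + m) ≡ a + b + c + 2 * m
      rearrange = solve-∀
    letter 1F = rearrange (corner 0F w) (corner 1F w) (corner 2F w) (M n)
      where
      rearrange : ∀ a b c m → a + m + b + (c + m) ≡ a + b + c + 2 * m
      rearrange = solve-∀
    letter 2F = rearrange (corner 0F w) (corner 1F w) (corner 2F w) (M n)
      where
      rearrange : ∀ a b c m → a + m + (b + m) + c ≡ a + b + c + 2 * m
      rearrange = solve-∀

  corner-sum : ∀ {i j} → i ≢ j → ∀ {n} (w : Word n) →
               corner i w + corner j w + corner (third i j) w ≡ 2 * L n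
  corner-sum i≢j w = trans (sym (Σ₃-third (λ i → corner i w) i≢j)) (Σ₃-corner w)

  L≤corner+corner : ∀ {i j} → i ≢ j → ∀ {n} (w : Word n) → L n ≤ corner i w + corner j w
  L≤corner+corner {i} {j} i≢j {n} w =
    by-slack 0 (≤-reflexive (sym (corner-sum i≢j w)) ⊕ corner≤L (third i j) w)
      (rearrange (L n) (corner i w) (corner j w) (corner (third i j) w))
    where
    rearrange : ∀ l a b c → l + (a + b + c + l) + 0 ≡ 2 * l + c + (a + b)
    rearrange = solve-∀

  Σʷ-corner-suc : ∀ i n → Σʷ (suc n) (corner i) ≡ 3 * Σʷ n (corner i) + 2 * (3 ^ n * M n)
  Σʷ-corner-suc i n with j , i≢j ← ∃≢ i = begin
    Σ₃ (λ h → Σʷ n (λ w → corner i (h ∷ w)))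
      ≡⟨ Σ₃-third (λ h → Σʷ n (λ w → corner i (h ∷ w))) i≢j ⟩
    Σʷ n (λ w → corner i (i ∷ w)) + Σʷ n (λ w → corner i (j ∷ w))
      + Σʷ n (λ w → corner i (third i j ∷ w))
      ≡⟨ cong₂ _+_ (cong₂ _+_ (Σʷ-cong n (corner-≡ i)) (far i≢j)) (far (third-≢ˡ i j i≢j ∘ sym)) ⟩
    Σʷ n (corner i) + (Σʷ n (corner i) + M n * 3 ^ n) + (Σʷ n (corner i) + M n * 3 ^ n)
      ≡⟨ rearrange (Σʷ n (corner i)) (M n) (3 ^ n) ⟩
    3 * Σʷ n (corner i) + 2 * (3 ^ n * M n) ∎
    where
    open ≡-Reasoning
    far : ∀ {h} → i ≢ h → Σʷ n (λ w → corner i (h ∷ w)) ≡ Σʷ n (corner i) + M n * 3 ^ n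
    far i≢h = trans (Σʷ-cong n (λ w → corner-≢ w i≢h))
                (trans (Σʷ-+ n (corner i) (λ _ → M n))
                  (cong (Σʷ n (corner i) +_) (Σʷ-const n (M n))))
    rearrange : ∀ e m N → e + (e + m * N) + (e + m * N) ≡ 3 * e + 2 * (N * m)
    rearrange = solve-∀

  -- The total distance of an extreme vertex, by `Σʷ-corner`.
  E : ℕ → ℕ
  E zero    = 0
  E (suc n) = 3 * E n + 2 * (3 ^ n * M n)

  Σʷ-corner : ∀ i n → Σʷ n (corner i) ≡ E n
  Σʷ-corner i zero    = refl
  Σʷ-corner i (suc n) =
    trans (Σʷ-corner-suc i n) (cong (λ e → 3 * e + 2 * (3 ^ n * M n)) (Σʷ-corner i n))

  -- Split by the first letter of u: in part i the subtracted distance grows by `M n`, in part k the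
  -- other one does, and in the third part both grow and the growth cancels.
  Σʷ-corner-∸ : ∀ {i k} → i ≢ k → ∀ n p q →
                Σʷ n (λ u → (corner i u + p) ∸ (corner k u + q)) ≡ κ n p q
  Σʷ-corner-∸ i≢k zero p q = refl
  Σʷ-corner-∸ {i} {k} i≢k (suc n) p q = begin
    Σ₃ s
      ≡⟨ Σ₃-third s i≢k ⟩
    s i + s k + s h
      ≡⟨ acb (s i) (s k) (s h) ⟩
    s i + s h + s k
      ≡⟨ cong₂ _+_ (cong₂ _+_ (Σʷ-cong n at-i) (Σʷ-cong n at-h)) (Σʷ-cong n at-k) ⟩
    Σʷ n (λ u → (corner i u + p) ∸ (corner k u + (q + M n)))
      + Σʷ n (λ u → (corner i u + p) ∸ (corner k u + q))
      + Σʷ n (λ u → (corner i u + (p + M n)) ∸ (corner k u + q))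
      ≡⟨ cong₂ _+_ (cong₂ _+_ (Σʷ-corner-∸ i≢k n p (q + M n)) (Σʷ-corner-∸ i≢k n p q))
                   (Σʷ-corner-∸ i≢k n (p + M n) q) ⟩
    κ n p (q + M n) + κ n p q + κ n (p + M n) q ∎
    where
    open ≡-Reasoning
    h = third i k
    s : T → ℕ
    s j = Σʷ n (λ u → (corner i (j ∷ u) + p) ∸ (corner k (j ∷ u) + q))
    acb : ∀ a b c → a + b + c ≡ a + c + b
    acb = solve-∀
    swap : ∀ a b c → a + b + c ≡ a + (c + b)
    swap = solve-∀
    shunt : ∀ a b c → a + b + c ≡ b + (a + c)
    shunt = solve-∀
    at-i : ∀ u → (corner i (i ∷ u) + p) ∸ (corner k (i ∷ u) + q)
               ≡ (corner i u + p) ∸ (corner k u + (q + M n))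
    at-i u = cong₂ _∸_ (cong (_+ p) (corner-≡ i u))
      (trans (cong (_+ q) (corner-≢ u (i≢k ∘ sym))) (swap (corner k u) (M n) q))
    at-k : ∀ u → (corner i (k ∷ u) + p) ∸ (corner k (k ∷ u) + q)
               ≡ (corner i u + (p + M n)) ∸ (corner k u + q)
    at-k u = cong₂ _∸_
      (trans (cong (_+ p) (corner-≢ u i≢k)) (swap (corner i u) (M n) p))
      (cong (_+ q) (corner-≡ k u))
    at-h : ∀ u → (corner i (h ∷ u) + p) ∸ (corner k (h ∷ u) + q)
               ≡ (corner i u + p) ∸ (corner k u + q)
    at-h u = trans (cong₂ _∸_
      (trans (cong (_+ p) (corner-≢ u (third-≢ˡ i k i≢k ∘ sym))) (shunt (corner i u) (M n) p))
      (trans (cong (_+ q) (corner-≢ u (third-≢ʳ i k i≢k ∘ sym))) (shunt (corner k u) (M n) q)))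
      ([m+n]∸[m+o]≡n∸o (M n) (corner i u + p) (corner k u + q))

  -- The candidates are the path across the edge between parts i and j and the path through part k.
  -- The latter crosses a whole side and a second edge, which together make `M n`.
  d : ∀ {n} → Word n → Word n → ℕ
  d []              []      = 0
  d {suc n} (i ∷ s) (j ∷ t) with i ≟ j
  ... | yes _ = d s t
  ... | no  _ = (corner j s + link n + corner i t)
              ⊓ (corner k s + link n + (M n + corner k t))
    where k = third i j

  d-≡ : ∀ i {n} (s t : Word n) → d (i ∷ s) (i ∷ t) ≡ d s t
  d-≡ i s t with i ≟ i
  ... | yes _   = refl
  ... | no  i≢i = contradiction refl i≢i

  d-≢ : ∀ {i j n} (s t : Word n) → i ≢ j →
        d (i ∷ s) (j ∷ t) ≡ (corner j s + link n + corner i t)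
                          ⊓ (corner (third i j) s + link n + (M n + corner (third i j) t))
  d-≢ {i} {j} s t i≢j with i ≟ j
  ... | yes i≡j = contradiction i≡j i≢j
  ... | no  _   = refl

  d-refl : ∀ {n} (s : Word n) → d s s ≡ 0
  d-refl []      = refl
  d-refl (i ∷ s) = trans (d-≡ i s s) (d-refl s)

  d-sym : ∀ {n} (s t : Word n) → d s t ≡ d t s
  d-sym []      []      = refl
  d-sym {suc n} (i ∷ s) (j ∷ t) with i ≟ j | j ≟ i
  ... | yes _   | yes _   = d-sym s t
  ... | yes i≡j | no  j≢i = contradiction (sym i≡j) j≢i
  ... | no  i≢j | yes j≡i = contradiction (sym j≡i) i≢j
  ... | no  _   | no  _ rewrite third-comm j i =
    cong₂ _⊓_ (rev (corner j s) (link n) (corner i t))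
              (rev′ (corner k s) (link n) (M n) (corner k t))
    where
    k = third i j
    rev : ∀ a b c → a + b + c ≡ c + b + a
    rev = solve-∀
    rev′ : ∀ a b m c → a + b + (m + c) ≡ c + b + (m + a)
    rev′ = solve-∀

  d-cornerˡ : ∀ i {n} (w : Word n) → d (replicate n i) w ≡ corner i w
  d-cornerˡ i []      = refl
  d-cornerˡ i {suc n} (j ∷ w) with i ≟ j
  ... | yes _   = d-cornerˡ i w
  ... | no  i≢j rewrite corner-replicate-≢ n (i≢j ∘ sym)
                      | corner-replicate-≢ n (third-≢ˡ i j i≢j) =
    trans (m≤n⇒m⊓n≡m (+-monoʳ-≤ (M n)
             (≤-trans (corner≤L i w) (≤-trans (L≤M n) (m≤m+n (M n) _)))))
          (+-comm (M n) (corner i w))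

  corner-triangle : ∀ i {n} (v u : Word n) → corner i u ≤ corner i v + d v u
  corner-triangle i []      []      = z≤n
  corner-triangle i {suc n} (g ∷ v) (h ∷ u) with g ≟ h
  ... | yes refl with i ≟ g
  ...   | yes _ = corner-triangle i v u
  ...   | no  _ = by-slack 0 (corner-triangle i v u)
                    (rearrange (corner i u) (corner i v) (d v u) (M n))
    where
    rearrange : ∀ a b c m → a + m + (b + c) + 0 ≡ a + (b + m + c)
    rearrange = solve-∀
  corner-triangle i {suc n} (g ∷ v) (h ∷ u) | no g≢h with i ≟ h | i ≟ g
  ... | yes refl | yes refl = contradiction refl g≢h
  ... | yes refl | no _ = ≤-trans (corner≤L i u) (≤-trans (L≤M n)
          (≤-trans (m≤n+m (M n) (corner i v)) (m≤m+n _ _)))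
  ... | no _ | yes refl = ≤-trans (⊓-glb
          (by-slack 0 (L≤corner+corner g≢h v)
            (direct (corner i u) (corner i v) (corner h v) (L n) (link n)))
          (by-slack (link n + corner k u)
            (corner≤L i u ⊕ L≤corner+corner (third-≢ˡ g h g≢h ∘ sym) v)
            (detour (corner i u) (corner i v) (corner k v) (corner k u) (L n) (link n) (M n))))
        (≤-reflexive (sym (+-distribˡ-⊓ (corner i v) _ _)))
    where
    k = third g h
    direct : ∀ a b c l m → a + (l + m) + (b + c) + 0 ≡ l + (b + (c + m + a))
    direct = solve-∀
    detour : ∀ a b c e l w m →
      a + m + (l + (b + c)) + (w + e) ≡ a + l + (b + (c + w + (m + e)))
    detour = solve-∀
  ... | no i≢h | no i≢g with refl ← third-unique g h i g≢h i≢g i≢h =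
    ≤-trans (⊓-glb
      (by-slack (link n + corner g u)
        (corner≤L i u ⊕ L≤corner+corner (third-≢ʳ g h g≢h) v)
        (direct (corner i u) (corner i v) (corner h v) (corner g u) (L n) (link n) (M n)))
      (by-slack (corner i v + corner i v + link n + M n) (z≤n {0})
        (detour (corner i u) (corner i v) (link n) (M n))))
      (≤-reflexive (sym (+-distribˡ-⊓ (corner i v + M n) _ _)))
    where
    direct : ∀ a b c e l w m →
      a + m + (l + (b + c)) + (w + e) ≡ a + l + (b + m + (c + w + e))
    direct = solve-∀
    detour : ∀ a b w m → a + m + 0 + (b + b + w + m) ≡ b + m + (b + w + (m + a))
    detour = solve-∀

  totalᵂ : ∀ {n} → Word n → ℕ
  totalᵂ {n} v = Σʷ n (d v)

  -- The triangle inequality through v, summed over all words.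
  E≤total+corner : ∀ i {n} (v : Word n) → E n ≤ totalᵂ v + corner i v * 3 ^ n
  E≤total+corner i {n} v = begin
    E n                                ≡⟨ Σʷ-corner i n ⟨
    Σʷ n (corner i)                    ≤⟨ Σʷ-mono n (corner-triangle i v) ⟩
    Σʷ n (λ u → corner i v + d v u)    ≡⟨ Σʷ-+ n (λ _ → corner i v) (d v) ⟩
    Σʷ n (λ _ → corner i v) + totalᵂ v ≡⟨ cong (_+ totalᵂ v) (Σʷ-const n (corner i v)) ⟩
    corner i v * 3 ^ n + totalᵂ v      ≡⟨ +-comm _ (totalᵂ v) ⟩
    totalᵂ v + corner i v * 3 ^ n      ∎
    where open ≤-Reasoning

  private
    -- A minimum of direct and detour plus direct ∸ detour is direct again. Summed over u, the
    -- truncated differences form κ, and the direct paths have an explicit total.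
    Σʷ-d-≢ : ∀ {i j} → i ≢ j → ∀ {n} (w : Word n) → let k = third i j in
      Σʷ n (λ u → d (i ∷ w) (j ∷ u)) + κ n (corner j w) (corner k w + M n)
      ≡ E n + (corner j w + link n) * 3 ^ n
    Σʷ-d-≢ {i} {j} i≢j {n} w = begin
      Σʷ n (λ u → d (i ∷ w) (j ∷ u)) + κ n (corner j w) (corner k w + M n)
        ≡⟨ cong (Σʷ n (λ u → d (i ∷ w) (j ∷ u)) +_) (Σʷ-corner-∸ (third-≢ˡ i j i≢j ∘ sym) n _ _) ⟨
      Σʷ n (λ u → d (i ∷ w) (j ∷ u))
        + Σʷ n (λ u → (corner i u + corner j w) ∸ (corner k u + (corner k w + M n)))
        ≡⟨ Σʷ-+ n _ _ ⟨
      Σʷ n (λ u → d (i ∷ w) (j ∷ u)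
                  + ((corner i u + corner j w) ∸ (corner k u + (corner k w + M n))))
        ≡⟨ Σʷ-cong n pointwise ⟩
      Σʷ n (λ u → corner i u + (corner j w + link n))
        ≡⟨ Σʷ-+ n (corner i) _ ⟩
      Σʷ n (corner i) + Σʷ n (λ _ → corner j w + link n)
        ≡⟨ cong₂ _+_ (Σʷ-corner i n) (Σʷ-const n _) ⟩
      E n + (corner j w + link n) * 3 ^ n ∎
      where
      open ≡-Reasoning
      k = third i j
      eq₁ : ∀ c b l → l + (c + b) ≡ b + l + c
      eq₁ = solve-∀
      eq₂ : ∀ c b l m → l + (c + (b + m)) ≡ b + l + (m + c)
      eq₂ = solve-∀
      eq₃ : ∀ c b l → b + l + c ≡ c + (b + l)
      eq₃ = solve-∀
      pointwise : ∀ u → d (i ∷ w) (j ∷ u)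
                        + ((corner i u + corner j w) ∸ (corner k u + (corner k w + M n)))
                      ≡ corner i u + (corner j w + link n)
      pointwise u = begin
        d (i ∷ w) (j ∷ u) + ((corner i u + corner j w) ∸ (corner k u + (corner k w + M n)))
          ≡⟨ cong₂ _+_ (d-≢ w u i≢j) (sym ([m+n]∸[m+o]≡n∸o (link n) _ _)) ⟩
        (direct ⊓ detour)
          + ((link n + (corner i u + corner j w)) ∸ (link n + (corner k u + (corner k w + M n))))
          ≡⟨ cong ((direct ⊓ detour) +_) (cong₂ _∸_ (eq₁ (corner i u) (corner j w) (link n))
                                                    (eq₂ (corner k u) (corner k w) (link n)
                                                      (M n))) ⟩
        (direct ⊓ detour) + (direct ∸ detour)
          ≡⟨ cong (_+ (direct ∸ detour)) (⊓-comm direct detour) ⟩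
        (detour ⊓ direct) + (direct ∸ detour)
          ≡⟨ m⊓n+n∸m≡n detour direct ⟩
        direct
          ≡⟨ eq₃ (corner i u) (corner j w) (link n) ⟩
        corner i u + (corner j w + link n) ∎
        where
        direct = corner j w + link n + corner i u
        detour = corner k w + link n + (M n + corner k u)

  -- Part i contributes `totalᵂ w`. Parts j and k follow from `Σʷ-d-≢`, with the roles of direct and
  -- detour corner exchanged.
  totalᵂ-∷ : ∀ {i j} → i ≢ j → ∀ {n} (w : Word n) → let b = corner j w ; c = corner (third i j) w in
    totalᵂ (i ∷ w) + (κ n b (c + M n) + κ n c (b + M n))
    ≡ totalᵂ w + 3 ^ n * (b + c + 2 * link n) + 2 * E n
  totalᵂ-∷ {i} {j} i≢j {n} w = begin
    Σ₃ s + (κ n b (c + M n) + κ n c (b + M n))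
      ≡⟨ cong (_+ (κ n b (c + M n) + κ n c (b + M n))) (Σ₃-third s i≢j) ⟩
    s i + s j + s k + (κ n b (c + M n) + κ n c (b + M n))
      ≡⟨ interchange (s i) (s j) (s k) (κ n b (c + M n)) (κ n c (b + M n)) ⟩
    s i + (s j + κ n b (c + M n)) + (s k + κ n c (b + M n))
      ≡⟨ cong₂ _+_ (cong₂ _+_ (Σʷ-cong n (d-≡ i w)) (Σʷ-d-≢ i≢j w)) at-k ⟩
    totalᵂ w + (E n + (b + link n) * 3 ^ n) + (E n + (c + link n) * 3 ^ n)
      ≡⟨ collect (totalᵂ w) (E n) b c (link n) (3 ^ n) ⟩
    totalᵂ w + 3 ^ n * (b + c + 2 * link n) + 2 * E n ∎
    where
    open ≡-Reasoning
    k = third i j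
    b = corner j w
    c = corner k w
    i≢k : i ≢ k
    i≢k = third-≢ˡ i j i≢j ∘ sym
    s : T → ℕ
    s h = Σʷ n (λ u → d (i ∷ w) (h ∷ u))
    at-k : s k + κ n c (b + M n) ≡ E n + (c + link n) * 3 ^ n
    at-k = subst (λ h → s k + κ n c (corner h w + M n) ≡ E n + (c + link n) * 3 ^ n)
                 (third-involutive i j i≢j) (Σʷ-d-≢ i≢k w)
    interchange : ∀ a b c x y → a + b + c + (x + y) ≡ a + (b + x) + (c + y)
    interchange = solve-∀
    collect : ∀ f e b c l N →
      f + (e + (b + l) * N) + (e + (c + l) * N) ≡ f + N * (b + c + 2 * l) + 2 * e
    collect = solve-∀

-- Total distances unfolded over two letters.

module TwoLevels (ω : ℕ) where
  open Weights ω
  open Words ω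


  κ-far : ∀ n {x} y → x ≤ L n → κ n x (y + (M n + M n)) ≡ 0
  κ-far n {x} y x≤L =
    κ-zero n (≤-trans (+-mono-≤ (≤-trans x≤L (L≤M n)) (L≤M n)) (m≤n+m (M n + M n) y))

  -- Brings the correction for a word with one more letter back to level n; its corner distances are
  -- those of the tail, with or without `M n`. The doubling of `M` is `M-suc-suc` for positive n but
  -- fails for n = 0 and ω = 0, so it is passed as an argument.
  κ-suc-shifted : ∀ n → M (suc n) ≡ M n + M n → ∀ {x y} → x ≤ L n →
    κ (suc n) (x + M n) (y + M (suc n)) ≡ κ n x (y + M n) + κ n x y
  κ-suc-shifted n M′≡2M {x} {y} x≤L rewrite M′≡2M = begin
    κ n (x + M n) (y + MM + M n) + κ n (x + M n) (y + MM) + κ n (x + M n + M n) (y + MM)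
      ≡⟨ cong₂ _+_ (cong₂ _+_ (κ-shift n (M n))
        (trans (cong (κ n _) (sym (+-assoc y _ _))) (κ-shift n (M n))))
                   (trans (cong (λ p → κ n p (y + MM)) (+-assoc x _ _)) (κ-shift n MM)) ⟩
    κ n x (y + MM) + κ n x (y + M n) + κ n x y
      ≡⟨ cong (λ z → z + κ n x (y + M n) + κ n x y) (κ-far n y x≤L) ⟩
    κ n x (y + M n) + κ n x y ∎
    where
    open ≡-Reasoning
    MM = M n + M n

  κ-suc-unshifted : ∀ n → M (suc n) ≡ M n + M n → ∀ {x y} → x ≤ L n →
    κ (suc n) x (y + M (suc n)) ≡ κ n x (y + M n)
  κ-suc-unshifted n M′≡2M {x} {y} x≤L rewrite M′≡2M = begin
    κ n x (y + MM + M n) + κ n x (y + MM) + κ n (x + M n) (y + MM)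
      ≡⟨ cong₂ _+_ (cong₂ _+_ (trans (cong (κ n x) (swap y MM (M n))) (κ-far n (y + M n) x≤L))
        (κ-far n y x≤L))
                   (trans (cong (κ n _) (sym (+-assoc y _ _))) (κ-shift n (M n))) ⟩
    κ n x (y + M n) ∎
    where
    open ≡-Reasoning
    MM = M n + M n
    swap : ∀ p x y → p + x + y ≡ p + y + x
    swap = solve-∀

  -- The part of the total distance of a word of length n + 2 that depends on n only.
  base : ℕ → ℕ
  base n = 3 ^ n * (2 * link n) + 2 * E n + 3 ^ suc n * (M n + 2 * link (suc n)) + 2 * E (suc n)

  -- Two uses of `totalᵂ-∷`. The word j v has distances b and c + M n to the corners j and k, so one
  -- of the two outer corrections vanishes and the other splits in two.
  totalᵂ-∷∷-≢ : ∀ {i j} → i ≢ j → ∀ {n} → M (suc n) ≡ M n + M n → (v : Word n) → let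
      N = 3 ^ n ; a = corner i v ; b = corner j v ; c = corner (third i j) v in
    totalᵂ (i ∷ j ∷ v)
      + ((κ n c (b + M n) + κ n c b) + (κ n a (c + M n) + κ n c (a + M n)))
    ≡ totalᵂ v + N * (a + c) + 3 * N * (b + c) + base n
  totalᵂ-∷∷-≢ {i} {j} i≢j {n} M′≡2M v = combine
    (totalᵂ (i ∷ j ∷ v)) (totalᵂ (j ∷ v)) (totalᵂ v) a b c (M n) (link n) (link (suc n)) N (E n)
      (E (suc n))
    (κ n c (b + M n) + κ n c b) (κ n a (c + M n) + κ n c (a + M n)) outer inner
    where
    N = 3 ^ n
    k = third i j
    a = corner i v
    b = corner j v
    c = corner k v
    inner : totalᵂ (j ∷ v) + (κ n a (c + M n) + κ n c (a + M n))
          ≡ totalᵂ v + N * (a + c + 2 * link n) + 2 * E n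
    inner = subst (λ h → totalᵂ (j ∷ v) + (κ n a (corner h v + M n) + κ n (corner h v) (a + M n))
                       ≡ totalᵂ v + N * (a + corner h v + 2 * link n) + 2 * E n)
                  (third-comm j i) (totalᵂ-∷ (i≢j ∘ sym) v)
    outer : totalᵂ (i ∷ j ∷ v) + (κ n c (b + M n) + κ n c b)
          ≡ totalᵂ (j ∷ v) + 3 * N * (b + (c + M n) + 2 * link (suc n)) + 2 * E (suc n)
    outer = trans (cong (totalᵂ (i ∷ j ∷ v) +_) (sym (begin
      κ (suc n) (corner j (j ∷ v)) (corner k (j ∷ v) + M (suc n))
        + κ (suc n) (corner k (j ∷ v)) (corner j (j ∷ v) + M (suc n))
        ≡⟨ cong₂ (λ b c → κ (suc n) b (c + M (suc n)) + κ (suc n) c (b + M (suc n))) at-j at-k ⟩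
      κ (suc n) b (c + M n + M (suc n)) + κ (suc n) (c + M n) (b + M (suc n))
        ≡⟨ cong₂ _+_ (trans (κ-suc-unshifted n M′≡2M {b} {c + M n} (corner≤L j v))
          (trans (cong (κ n b) (+-assoc c _ _)) (κ-far n c (corner≤L j v))))
                     (κ-suc-shifted n M′≡2M {c} {b} (corner≤L k v)) ⟩
      κ n c (b + M n) + κ n c b ∎)))
      (trans (totalᵂ-∷ i≢j (j ∷ v))
        (cong₂ (λ b c → totalᵂ (j ∷ v) + 3 * N * (b + c + 2 * link (suc n)) + 2 * E (suc n))
          at-j at-k))
      where
      open ≡-Reasoning
      at-j : corner j (j ∷ v) ≡ b
      at-j = corner-≡ j v
      at-k : corner k (j ∷ v) ≡ c + M n
      at-k = corner-≢ v (third-≢ʳ i j i≢j)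
    combine : ∀ t₂ t₁ t a b c M l l′ N e e′ r r′ →
      t₂ + r ≡ t₁ + 3 * N * (b + (c + M) + 2 * l′) + 2 * e′ →
      t₁ + r′ ≡ t + N * (a + c + 2 * l) + 2 * e →
      t₂ + (r + r′) ≡ t + N * (a + c) + 3 * N * (b + c)
        + (N * (2 * l) + 2 * e + 3 * N * (M + 2 * l′) + 2 * e′)
    combine t₂ t₁ t a b c M l l′ N e e′ r r′ eq₂ eq₁ = begin
      t₂ + (r + r′)
        ≡⟨ +-assoc t₂ r r′ ⟨
      t₂ + r + r′
        ≡⟨ cong (_+ r′) eq₂ ⟩
      t₁ + 3 * N * (b + (c + M) + 2 * l′) + 2 * e′ + r′
        ≡⟨ shuffle t₁ (3 * N * (b + (c + M) + 2 * l′)) (2 * e′) r′ ⟩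
      t₁ + r′ + (3 * N * (b + (c + M) + 2 * l′) + 2 * e′)
        ≡⟨ cong (_+ (3 * N * (b + (c + M) + 2 * l′) + 2 * e′)) eq₁ ⟩
      t + N * (a + c + 2 * l) + 2 * e + (3 * N * (b + (c + M) + 2 * l′) + 2 * e′)
        ≡⟨ solve (t ∷ₗ a ∷ₗ b ∷ₗ c ∷ₗ M ∷ₗ l ∷ₗ l′ ∷ₗ N ∷ₗ e ∷ₗ e′ ∷ₗ []ₗ) ⟩
      _ ∎
      where
      open ≡-Reasoning
      shuffle : ∀ t x y r → t + x + y + r ≡ t + r + (x + y)
      shuffle = solve-∀

  totalᵂ-∷∷-≡ : ∀ {i j} → i ≢ j → ∀ {n} → M (suc n) ≡ M n + M n → (v : Word n) → let
      N = 3 ^ n ; b = corner j v ; c = corner (third i j) v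
      r = κ n b (c + M n) + κ n c (b + M n) in
    totalᵂ (i ∷ i ∷ v) + (r + r) ≡ totalᵂ v + 4 * N * (b + c) + 3 * N * M n + base n
  totalᵂ-∷∷-≡ {i} {j} i≢j {n} M′≡2M v = combine
    (totalᵂ (i ∷ i ∷ v)) (totalᵂ (i ∷ v)) (totalᵂ v) b c (M n) (link n) (link (suc n)) N (E n)
      (E (suc n))
    (κ n b (c + M n) + κ n c (b + M n)) outer (totalᵂ-∷ i≢j v)
    where
    N = 3 ^ n
    k = third i j
    b = corner j v
    c = corner k v
    drop : ∀ {x y} → x ≤ L n → κ (suc n) (x + M n) (y + M n + M (suc n)) ≡ κ n x (y + M n)
    drop {x} {y} x≤L = trans (κ-suc-shifted n M′≡2M x≤L)
      (cong (_+ κ n x (y + M n)) (trans (cong (κ n x) (+-assoc y (M n) (M n))) (κ-far n y x≤L)))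
    outer : totalᵂ (i ∷ i ∷ v) + (κ n b (c + M n) + κ n c (b + M n))
          ≡ totalᵂ (i ∷ v) + 3 * N * (b + M n + (c + M n) + 2 * link (suc n)) + 2 * E (suc n)
    outer = trans (cong (totalᵂ (i ∷ i ∷ v) +_) (sym (begin
      κ (suc n) (corner j (i ∷ v)) (corner k (i ∷ v) + M (suc n))
        + κ (suc n) (corner k (i ∷ v)) (corner j (i ∷ v) + M (suc n))
        ≡⟨ cong₂ (λ b c → κ (suc n) b (c + M (suc n)) + κ (suc n) c (b + M (suc n))) at-j at-k ⟩
      κ (suc n) (b + M n) (c + M n + M (suc n)) + κ (suc n) (c + M n) (b + M n + M (suc n))
        ≡⟨ cong₂ _+_ (drop {b} {c} (corner≤L j v)) (drop {c} {b} (corner≤L k v)) ⟩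
      κ n b (c + M n) + κ n c (b + M n) ∎)))
      (trans (totalᵂ-∷ i≢j (i ∷ v))
        (cong₂ (λ b c → totalᵂ (i ∷ v) + 3 * N * (b + c + 2 * link (suc n)) + 2 * E (suc n))
          at-j at-k))
      where
      open ≡-Reasoning
      at-j : corner j (i ∷ v) ≡ b + M n
      at-j = corner-≢ v (i≢j ∘ sym)
      at-k : corner k (i ∷ v) ≡ c + M n
      at-k = corner-≢ v (third-≢ˡ i j i≢j)
    combine : ∀ t₂ t₁ t b c M l l′ N e e′ r →
      t₂ + r ≡ t₁ + 3 * N * (b + M + (c + M) + 2 * l′) + 2 * e′ →
      t₁ + r ≡ t + N * (b + c + 2 * l) + 2 * e →
      t₂ + (r + r) ≡ t + 4 * N * (b + c) + 3 * N * M
        + (N * (2 * l) + 2 * e + 3 * N * (M + 2 * l′) + 2 * e′)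
    combine t₂ t₁ t b c M l l′ N e e′ r eq₂ eq₁ = begin
      t₂ + (r + r)
        ≡⟨ +-assoc t₂ r r ⟨
      t₂ + r + r
        ≡⟨ cong (_+ r) eq₂ ⟩
      t₁ + 3 * N * (b + M + (c + M) + 2 * l′) + 2 * e′ + r
        ≡⟨ shuffle t₁ (3 * N * (b + M + (c + M) + 2 * l′)) (2 * e′) r ⟩
      t₁ + r + (3 * N * (b + M + (c + M) + 2 * l′) + 2 * e′)
        ≡⟨ cong (_+ (3 * N * (b + M + (c + M) + 2 * l′) + 2 * e′)) eq₁ ⟩
      t + N * (b + c + 2 * l) + 2 * e + (3 * N * (b + M + (c + M) + 2 * l′) + 2 * e′)
        ≡⟨ solve (t ∷ₗ b ∷ₗ c ∷ₗ M ∷ₗ l ∷ₗ l′ ∷ₗ N ∷ₗ e ∷ₗ e′ ∷ₗ []ₗ) ⟩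
      _ ∎
      where
      open ≡-Reasoning
      shuffle : ∀ t x y r → t + x + y + r ≡ t + r + (x + y)
      shuffle = solve-∀

-- Linear inequalities behind the optimality estimates.

-- The total distances enter with the factor 3 because of the denominator in κ-linear.
head-arith : ∀ F F₀ r a b c l k N e →
  F + r ≡ F₀ + N * (b + c + 2 * k) + 2 * e →
  e ≤ F₀ + a * N → 3 * r ≤ a * N → a + b + c ≡ 2 * l →
  3 * (3 * e + 2 * (N * (l + k))) ≤ 3 * F + 7 * (a * N)
head-arith F F₀ r a b c l k N e hF h₁ h₂ h₃ =
  by-slack 0 (3 ⊛ ≤-reflexive (sym hF) ⊕ 3 ⊛ h₁ ⊕ h₂ ⊕ 3 * N ⊛ ≤-reflexive (sym h₃))
    (solve (F ∷ₗ F₀ ∷ₗ r ∷ₗ a ∷ₗ b ∷ₗ c ∷ₗ l ∷ₗ k ∷ₗ N ∷ₗ e ∷ₗ []ₗ))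

same-arith : ∀ F F₀ r a b c l M N e B →
  F + (r + r) ≡ F₀ + 4 * N * (b + c) + 3 * N * M + B →
  e ≤ F₀ + a * N → 3 * r ≤ a * N → a + b + c ≡ 2 * l → a ≤ l → l ≤ M → 1 ≤ N * M →
  3 * (e + 4 * (N * l) + B) < 3 * F
same-arith F F₀ r a b c l M N e B hF h₁ h₂ h₃ h₄ h₅ h₆ =
  -- The summand `h₆` supplies the successor contained in the strict inequality.
  by-slack (3 * (N * M)) (3 ⊛ ≤-reflexive (sym hF) ⊕ 3 ⊛ h₁ ⊕ 2 ⊛ h₂ ⊕ 12 * N ⊛ ≤-reflexive (sym h₃)
      ⊕ 17 * N ⊛ h₄ ⊕ 5 * N ⊛ h₅ ⊕ h₆)
    (solve (F ∷ₗ F₀ ∷ₗ r ∷ₗ a ∷ₗ b ∷ₗ c ∷ₗ l ∷ₗ M ∷ₗ N ∷ₗ e ∷ₗ B ∷ₗ []ₗ))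

-- The balance in units of N * b, after tripling: the corner distances gain 9, the bound on `e`
-- costs 7 and `s` costs 1. What is left is N * b, hence strictness. In `near-arithᵏ` the same
-- balance holds with c for b.
near-arithʲ : ∀ F F₀ r s a b c l N e z B →
  F + (r + s) ≡ F₀ + 3 * N * (a + c) + 3 * (3 * N) * (b + c) + B →
  3 * e ≤ 3 * F₀ + 7 * (b * N) → 3 * s ≤ b * N → r + 3 * N * b ≤ z + 3 * N * c →
  a + b + c ≡ 2 * l → l ≤ c + b → 1 ≤ N * b →
  3 * (e + 4 * (3 * N * l) + B) < 3 * (F + z)
near-arithʲ F F₀ r s a b c l N e z B hF h₁ h₂ h₃ h₄ h₅ h₆ =
  by-slack 0 (3 ⊛ ≤-reflexive (sym hF) ⊕ h₁ ⊕ h₂ ⊕ 3 ⊛ h₃ ⊕ 9 * N ⊛ ≤-reflexive (sym h₄)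
      ⊕ 18 * N ⊛ h₅ ⊕ h₆)
    (solve (F ∷ₗ F₀ ∷ₗ r ∷ₗ s ∷ₗ a ∷ₗ b ∷ₗ c ∷ₗ l ∷ₗ N ∷ₗ e ∷ₗ z ∷ₗ B ∷ₗ []ₗ))

near-arithᵏ : ∀ F F₀ r s a b c l N e z B →
  F + (r + s) ≡ F₀ + 3 * N * (a + c) + 3 * (3 * N) * (b + c) + B →
  3 * e ≤ 3 * F₀ + 7 * (c * N) → 3 * (r + s) ≤ 3 * z + c * N →
  a + b + c ≡ 2 * l → l ≤ b + c → 1 ≤ N * c →
  3 * (e + 4 * (3 * N * l) + B) < 3 * (F + z)
near-arithᵏ F F₀ r s a b c l N e z B hF h₁ h₂ h₃ h₄ h₅ =
  by-slack 0 (3 ⊛ ≤-reflexive (sym hF) ⊕ h₁ ⊕ h₂ ⊕ 9 * N ⊛ ≤-reflexive (sym h₃)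
      ⊕ 18 * N ⊛ h₄ ⊕ h₅)
    (solve (F ∷ₗ F₀ ∷ₗ r ∷ₗ s ∷ₗ a ∷ₗ b ∷ₗ c ∷ₗ l ∷ₗ N ∷ₗ e ∷ₗ z ∷ₗ B ∷ₗ []ₗ))

far-arith : ∀ F F₀ r s a b c f l m N e B →
  F + (r + s) ≡ F₀ + 3 * N * (a + c) + 3 * (3 * N) * (b + c) + B →
  3 * e ≤ 3 * F₀ + 7 * (a * N) → 3 * s + 3 * N * a ≤ 3 * N * c →
  3 * r + 4 * (3 * N * f) ≤ 3 * N * (l + m) + 4 * (3 * N * c) →
  a + b + c ≡ 2 * (l + m) → a ≤ l → m ≤ b → m ≤ f → l ≤ m → 1 ≤ N * m →
  3 * (e + 4 * (3 * N * (l + m)) + B) < 3 * F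
far-arith F F₀ r s a b c f l m N e B hF h₁ h₂ h₃ h₄ h₅ h₆ h₇ h₈ h₉ =
  by-slack (7 * (N * m)) (3 ⊛ ≤-reflexive (sym hF) ⊕ h₁ ⊕ h₂ ⊕ h₃ ⊕ 21 * N ⊛ ≤-reflexive (sym h₄)
      ⊕ 16 * N ⊛ h₅ ⊕ 6 * N ⊛ h₆ ⊕ 12 * N ⊛ h₇ ⊕ 13 * N ⊛ h₈ ⊕ h₉)
    (solve (F ∷ₗ F₀ ∷ₗ r ∷ₗ s ∷ₗ a ∷ₗ b ∷ₗ c ∷ₗ f ∷ₗ l ∷ₗ m ∷ₗ N ∷ₗ e ∷ₗ B ∷ₗ []ₗ))

-- The central words and the comparison of all other words with them.

data Central {n} : Word (2 + n) → Set where
  outer : ∀ {i j} → i ≢ j → Central (i ∷ j ∷ replicate n j)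
  inner : ∀ {i j} → i ≢ j → Central (i ∷ j ∷ replicate n (third i j))

module Optimum (ω : ℕ) (ω≤1 : ω ≤ 1) where
  open Weights ω
  open Words ω
  open TwoLevels ω
  open κ-Bounds ω

  link≤1 : ∀ n → link n ≤ 1
  link≤1 zero    = ≤-refl
  link≤1 (suc n) = ω≤1

  link-suc≤link : ∀ n → link (suc n) ≤ link n
  link-suc≤link zero    = ω≤1
  link-suc≤link (suc n) = ≤-refl

  3^n*x>0 : ∀ n {x} → 0 < x → 1 ≤ 3 ^ n * x
  3^n*x>0 n x>0 = *-mono-≤ (m^n>0 3 n) x>0

  corner≤corner+corner : ∀ i {j l} → j ≢ l → ∀ {n} (w : Word n) →
    corner i w ≤ corner j w + corner l w
  corner≤corner+corner i j≢l w = ≤-trans (corner≤L i w) (L≤corner+corner j≢l w)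

  κ-pair-corner : ∀ {i j} → i ≢ j → ∀ {n} (w : Word n) → let
    b = corner j w ; c = corner (third i j) w in
    κ n b (c + M n) + κ n c (b + M n) ≤ κ n (corner i w) (M n)
  κ-pair-corner {i} {j} i≢j {n} w = κ-pair n
    (corner≤corner+corner j (third-≢ˡ i j i≢j ∘ sym) w)
    (corner≤corner+corner (third i j) i≢j w)

  -- The plain triangle bound `E≤total+corner` for the longer word would give 9 in place of 7, too
  -- much for the comparisons near the optimal corners. Splitting off one letter before using it
  -- makes the difference.
  E≤totalᵂ-head : ∀ i {n} (w : Word n) →
    3 * E (suc n) ≤ 3 * totalᵂ (i ∷ w) + 7 * (corner i w * 3 ^ n)
  E≤totalᵂ-head i {n} w with j , i≢j ← ∃≢ i =
    head-arith (totalᵂ (i ∷ w)) (totalᵂ w) _ (corner i w) (corner j w) (corner (third i j) w)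
      (L n) (link n) (3 ^ n) (E n)
      (totalᵂ-∷ i≢j w) (E≤total+corner i w)
      (≤-trans (3 ⊛ κ-pair-corner i≢j w) (κ-linear-M n (corner≤L i w)))
      (corner-sum i≢j w)

  totalᵂ-replicate : ∀ i n → totalᵂ (replicate n i) ≡ E n
  totalᵂ-replicate i n = trans (Σʷ-cong n (d-cornerˡ i)) (Σʷ-corner i n)

  -- The least total distance of a word of length n + 2 is opt n - gap n.
  opt : ℕ → ℕ
  opt n = E n + 4 * (3 ^ n * L n) + base n

  gap : ℕ → ℕ
  gap n = κ n (L n) (M n)

  module _ {n : ℕ} (M′≡2M : M (suc n) ≡ M n + M n) where

    -- At the corner j the distance b is 0 and a, c are `L n`. The corrections left are `gap n` and
    -- `κ n l 0`, which is l * 3 ^ n by `κ-flip`; this is what makes the value agree with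
    -- `opt-inner`.
    opt-outer : ∀ {i j} → i ≢ j → totalᵂ (i ∷ j ∷ replicate n j) + gap n ≡ opt n
    opt-outer {i} {j} i≢j = go (corner-replicate-≢ n i≢j) (corner-replicate-≡ j n)
      (corner-replicate-≢ n (third-≢ʳ i j i≢j)) (totalᵂ-replicate j n)
      (totalᵂ-∷∷-≢ i≢j M′≡2M (replicate n j))
      where
      l = L n
      N = 3 ^ n
      arith : ∀ {t z y e N l B} → y + 0 ≡ l * N →
        t + ((z + y) + 0) ≡ e + N * (l + l) + 3 * N * l + B → t + z ≡ e + 4 * (N * l) + B
      arith {t} {z} {y} {e} {N} {l} {B} h k = ≤-antisym
        (by-slack 0 (≤-reflexive (sym h) ⊕ ≤-reflexive k)
          (solve (t ∷ₗ z ∷ₗ y ∷ₗ e ∷ₗ N ∷ₗ l ∷ₗ B ∷ₗ []ₗ)))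
        (by-slack 0 (≤-reflexive h ⊕ ≤-reflexive (sym k))
          (solve (t ∷ₗ z ∷ₗ y ∷ₗ e ∷ₗ N ∷ₗ l ∷ₗ B ∷ₗ []ₗ)))
      go : ∀ {a b c t f} → a ≡ l → b ≡ 0 → c ≡ l → t ≡ E n →
        f + ((κ n c (b + M n) + κ n c b) + (κ n a (c + M n) + κ n c (a + M n)))
          ≡ t + N * (a + c) + 3 * N * (b + c) + base n →
        f + gap n ≡ opt n
      go {f = f} refl refl refl refl h = arith {f} {gap n} {κ n l 0} {E n} {N} {l} {base n}
        (trans (κ-flip n l 0) (cong (_+ l * N) (κ-zero n ≤-refl)))
        (trans (cong (λ x → f + ((gap n + κ n l 0) + (x + x)))
                     (sym (κ-zero n (+-monoʳ-≤ l (L≤M n))))) h)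

    opt-inner : ∀ {i j} → i ≢ j → totalᵂ (i ∷ j ∷ replicate n (third i j)) + gap n ≡ opt n
    opt-inner {i} {j} i≢j = go (corner-replicate-≢ n (third-≢ˡ i j i≢j ∘ sym))
      (corner-replicate-≢ n (third-≢ʳ i j i≢j ∘ sym)) (corner-replicate-≡ (third i j) n)
      (totalᵂ-replicate (third i j) n)
      (totalᵂ-∷∷-≢ i≢j M′≡2M (replicate n (third i j)))
      where
      l = L n
      N = 3 ^ n
      rearrange : ∀ e N l B → e + N * (l + 0) + 3 * N * (l + 0) + B ≡ e + 4 * (N * l) + B
      rearrange = solve-∀
      go : ∀ {a b c t f} → a ≡ l → b ≡ l → c ≡ 0 → t ≡ E n →
        f + ((κ n c (b + M n) + κ n c b) + (κ n a (c + M n) + κ n c (a + M n)))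
          ≡ t + N * (a + c) + 3 * N * (b + c) + base n →
        f + gap n ≡ opt n
      go {f = f} refl refl refl refl h = trans
        (cong (f +_) (sym (begin
          (κ n 0 (l + M n) + κ n 0 l) + (gap n + κ n 0 (l + M n))
            ≡⟨ cong₂ (λ x y → (x + y) + (gap n + x)) (κ-zero n (m≤m+n l (M n))) (κ-zero n ≤-refl) ⟩
          gap n + 0
            ≡⟨ +-identityʳ (gap n) ⟩
          gap n ∎)))
        (trans h (rearrange (E n) N l (base n)))
        where open ≡-Reasoning

    -- Staying in part i twice costs so much that the linear bounds suffice, even without adding
    -- `gap n`.
    opt<same : ∀ {i j} → i ≢ j → (v : Word n) → opt n < totalᵂ (i ∷ i ∷ v)
    opt<same {i} {j} i≢j v = *-cancelˡ-< 3 _ _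
      (same-arith (totalᵂ (i ∷ i ∷ v)) (totalᵂ v) (κ n b (c + M n) + κ n c (b + M n))
        (corner i v) b c (L n) (M n) (3 ^ n) (E n) (base n)
        (totalᵂ-∷∷-≡ i≢j M′≡2M v) (E≤total+corner i v)
        (≤-trans (3 ⊛ κ-pair-corner i≢j v) (κ-linear-M n (corner≤L i v)))
        (corner-sum i≢j v) (corner≤L i v) (L≤M n) (3^n*x>0 n (M>0 n)))
      where
      b = corner j v
      c = corner (third i j) v

  module _ {i j : T} (i≢j : i ≢ j) {m : ℕ} (w : Word m)
    (M″≡2M′ : M (suc (suc m)) ≡ M (suc m) + M (suc m)) where
    private
      n = suc m
      k = third i j
      i≢k : i ≢ k
      i≢k = third-≢ˡ i j i≢j ∘ sym
      j≢k : j ≢ k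
      j≢k = third-≢ʳ i j i≢j ∘ sym

    -- The distance b from v to the optimal corner j is the parameter: `κ-nearʲ` bounds the outer
    -- corrections, `κ-pair` and `κ-linear` the inner ones, and `E≤totalᵂ-head` the total distance
    -- of v.
    opt<nearʲ : 0 < corner j w → opt n < totalᵂ (i ∷ j ∷ j ∷ w) + gap n
    opt<nearʲ b>0 = *-cancelˡ-< 3 _ _
      (near-arithʲ (totalᵂ (i ∷ j ∷ v)) (totalᵂ v) (κ n c (b + M n) + κ n c b)
        (κ n a (c + M n) + κ n c (a + M n)) a b c (L n) (3 ^ m) (E n) (gap n) (base n)
        (totalᵂ-∷∷-≢ i≢j M″≡2M′ v)
        (subst (λ x → 3 * E n ≤ 3 * totalᵂ v + 7 * (x * 3 ^ m)) (sym b≡) (E≤totalᵂ-head j w))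
        (≤-trans (3 ⊛ pair) (≤-trans (3 ⊛ κ-mono n ≤-refl (L≤M n)) small))
        (κ-nearʲ n b+link≤c (≤-trans (corner≤L k v) (m≤n+m (L n) b)))
        (corner-sum i≢j v)
        (L≤corner+corner (j≢k ∘ sym) v)
        (3^n*x>0 m (subst (0 <_) (sym b≡) b>0)))
      where
      v = j ∷ w
      a = corner i v
      b = corner j v
      c = corner k v
      b≡ : b ≡ corner j w
      b≡ = corner-≡ j w
      c≡ : c ≡ corner k w + M m
      c≡ = corner-≢ w (j≢k ∘ sym)
      pair : κ n a (c + M n) + κ n c (a + M n) ≤ κ n b (M n)
      pair = κ-pair n (corner≤corner+corner i j≢k v) (corner≤corner+corner k (i≢j ∘ sym) v)
      small : 3 * κ n b (L n) ≤ b * 3 ^ m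
      small rewrite b≡ | κ-suc-small m (corner≤L j w) = κ-linear m (corner≤L j w)
      b+link≤c : b + link n ≤ c
      b+link≤c rewrite b≡ | c≡ =
        ≤-trans (+-mono-≤ (corner≤L j w) (link-suc≤link m)) (m≤n+m (M m) (corner k w))

    -- In part i both b and c are at least `M m`, which leaves enough room for the crude bounds.
    opt<far : opt n < totalᵂ (i ∷ j ∷ i ∷ w) + gap n
    opt<far = ≤-trans (*-cancelˡ-< 3 _ _
      (far-arith (totalᵂ (i ∷ j ∷ v)) (totalᵂ v) (κ n c (b + M n) + κ n c b)
        (κ n c (a + M n)) a b c (b ⊓ c) (L m) (M m) (3 ^ m) (E n) (base n)
        (subst (λ y → totalᵂ (i ∷ j ∷ v) + (κ n c (b + M n) + κ n c b + y)
          ≡ totalᵂ v + 3 ^ n * (a + c) + 3 * 3 ^ n * (b + c) + base n)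
          (cong (_+ κ n c (a + M n))
            (κ-zero n (≤-trans (+-monoˡ-≤ (L n) a≤c) (+-monoʳ-≤ c (L≤M n)))))
          (totalᵂ-∷∷-≢ i≢j M″≡2M′ v))
        (subst (λ x → 3 * E n ≤ 3 * totalᵂ v + 7 * (x * 3 ^ m)) (sym a≡) (E≤totalᵂ-head i w))
        (κ-linear-shift n a≤c (≤-trans (corner≤L k v) (m≤n+m (L n) a)))
        (κ-far-⊓ n {b} {c} (≤-trans (corner≤L k v) (m≤n+m (L n) b)))
        (corner-sum i≢j v)
        a≤l (M≤ (i≢j ∘ sym)) (⊓-glb (M≤ (i≢j ∘ sym)) (M≤ (i≢k ∘ sym))) (L≤M m)
        (3^n*x>0 m (M>0 m))))
      (m≤m+n (totalᵂ (i ∷ j ∷ v)) (gap n))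
      where
      v = i ∷ w
      a = corner i v
      b = corner j v
      c = corner k v
      a≡ : a ≡ corner i w
      a≡ = corner-≡ i w
      a≤l : a ≤ L m
      a≤l = subst (_≤ L m) (sym a≡) (corner≤L i w)
      M≤ : ∀ {h} → h ≢ i → M m ≤ corner h v
      M≤ {h} h≢i = subst (M m ≤_) (sym (corner-≢ w h≢i)) (m≤n+m (M m) (corner h w))
      a≤c : a ≤ c
      a≤c = ≤-trans a≤l (≤-trans (L≤M m) (M≤ (i≢k ∘ sym)))

  module _ {i j : T} (i≢j : i ≢ j) {m : ℕ} (w : Word m)
           (M′≡2M : M (suc m) ≡ M m + M m) (M″≡2M′ : M (suc (suc m)) ≡ M (suc m) + M (suc m)) where
    private
      n = suc m
      k = third i j
      i≢k : i ≢ k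
      i≢k = third-≢ˡ i j i≢j ∘ sym
      j≢k : j ≢ k
      j≢k = third-≢ʳ i j i≢j ∘ sym

    -- Here c is at most a and b, so two of the four corrections vanish. The other two are brought
    -- into the form of `κ-nearᵏ` by a ≤ L n ≤ b + c.
    opt<nearᵏ : 0 < corner k w → opt n < totalᵂ (i ∷ j ∷ k ∷ w) + gap n
    opt<nearᵏ c>0 = *-cancelˡ-< 3 _ _
      (near-arithᵏ (totalᵂ (i ∷ j ∷ v)) (totalᵂ v) (κ n c b) (κ n a (c + M n)) a b c (L n) (3 ^ m)
        (E n) (gap n) (base n)
        (subst₂ (λ x y → totalᵂ (i ∷ j ∷ v) + (x + y)
          ≡ totalᵂ v + 3 ^ n * (a + c) + 3 * 3 ^ n * (b + c) + base n)
          (cong (_+ κ n c b) (κ-zero n (≤-trans (+-monoˡ-≤ (L n) c≤b) (+-monoʳ-≤ b (L≤M n)))))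
          (trans (cong (κ n a (c + M n) +_)
            (κ-zero n (≤-trans (+-monoˡ-≤ (L n) c≤a) (+-monoʳ-≤ a (L≤M n)))))
                 (+-identityʳ _))
          (totalᵂ-∷∷-≢ i≢j M″≡2M′ v))
        (subst (λ x → 3 * E n ≤ 3 * totalᵂ v + 7 * (x * 3 ^ m)) (sym c≡) (E≤totalᵂ-head k w))
        (≤-trans (3 ⊛ (c-b ⊕ κ-mono n (corner≤L i v) ≤-refl)) (κ-nearᵏ m M′≡2M (link≤1 m) c≤l))
        (corner-sum i≢j v)
        (L≤corner+corner j≢k v)
        (3^n*x>0 m (subst (0 <_) (sym c≡) c>0)))
      where
      v = k ∷ w
      a = corner i v
      b = corner j v
      c = corner k v
      c≡ : c ≡ corner k w
      c≡ = corner-≡ k w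
      c≤l : c ≤ L m
      c≤l = subst (_≤ L m) (sym c≡) (corner≤L k w)
      M≤ : ∀ {h} → h ≢ k → M m ≤ corner h v
      M≤ {h} h≢k = subst (M m ≤_) (sym (corner-≢ w h≢k)) (m≤n+m (M m) (corner h w))
      c≤b : c ≤ b
      c≤b = ≤-trans c≤l (≤-trans (L≤M m) (M≤ j≢k))
      c≤a : c ≤ a
      c≤a = ≤-trans c≤l (≤-trans (L≤M m) (M≤ i≢k))
      c-b : κ n c b ≤ κ n (c + c) (L n)
      c-b = ≤-trans (≤-reflexive (sym (κ-shift n c))) (κ-mono n ≤-refl (L≤corner+corner j≢k v))

module Minimum (ω : ℕ) (ω≤1 : ω ≤ 1) where
  open Weights ω
  open Words ω
  open Optimum ω ω≤1

  central⇒opt : ∀ {m} {x : Word (3 + m)} → Central x → totalᵂ x + gap (suc m) ≡ opt (suc m)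
  central⇒opt {m} (outer i≢j) = opt-outer {suc m} (M-suc-suc m) i≢j
  central⇒opt {m} (inner i≢j) = opt-inner {suc m} (M-suc-suc m) i≢j

  central-or-opt< : ∀ {m} (x : Word (3 + m)) → Central x ⊎ opt (suc m) < totalᵂ x + gap (suc m)
  central-or-opt< {m} (i ∷ j ∷ h ∷ w) with i ≟ j
  ... | yes refl with j , i≢j ← ∃≢ i =
    inj₂ (≤-trans (opt<same {suc m} (M-suc-suc m) i≢j (h ∷ w)) (m≤m+n _ _))
  ... | no i≢j with h ≟ i | h ≟ j
  ...   | yes refl | _ = inj₂ (opt<far i≢j w (M-suc-suc m))
  ...   | no _ | yes refl with corner j w ℕ.≟ 0
  ...     | yes b≡0 rewrite corner≡0⇒replicate j w b≡0 = inj₁ (outer i≢j)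
  ...     | no  b≢0 = inj₂ (opt<nearʲ i≢j w (M-suc-suc m) (n≢0⇒n>0 b≢0))
  central-or-opt< {m} (i ∷ j ∷ h ∷ w) | no i≢j | no h≢i | no h≢j
    with refl ← third-unique i j h i≢j h≢i h≢j | corner h w ℕ.≟ 0
  ... | yes c≡0 rewrite corner≡0⇒replicate (third i j) w c≡0 = inj₁ (inner i≢j)
  -- The tail is empty and so lies at the corner. This spares `opt<nearᵏ` at level 0, where the
  -- doubling of `M` may fail.
  central-or-opt< {zero} (i ∷ j ∷ h ∷ []) | no i≢j | no h≢i | no h≢j | no c≢0 =
    contradiction refl c≢0
  central-or-opt< {suc m} (i ∷ j ∷ h ∷ w) | no i≢j | no h≢i | no h≢j | no c≢0 =
    inj₂ (opt<nearᵏ i≢j w (M-suc-suc m) (M-suc-suc (suc m)) (n≢0⇒n>0 c≢0))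

  central⇒minimal : ∀ {m} {x : Word (3 + m)} → Central x → ∀ y → totalᵂ x ≤ totalᵂ y
  central⇒minimal {m} {x} c y = +-cancelʳ-≤ (gap (suc m)) _ _ (begin
    totalᵂ x + gap (suc m) ≡⟨ central⇒opt {m} c ⟩
    opt (suc m)            ≤⟨ [ ≤-reflexive ∘ sym ∘ central⇒opt {m} , <⇒≤ ]′
      (central-or-opt< {m} y) ⟩
    totalᵂ y + gap (suc m) ∎)
    where open ≤-Reasoning

  minimal⇒central : ∀ {m} {x : Word (3 + m)} → (∀ y → totalᵂ x ≤ totalᵂ y) → Central x
  minimal⇒central {m} {x} x≤ with central-or-opt< {m} x
  ... | inj₁ c = c
  ... | inj₂ opt< = contradiction
    (≤-trans opt< (≤-trans (+-monoˡ-≤ (gap (suc m)) (x≤ x₀))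
      (≤-reflexive (central⇒opt {m} (outer {i = 0F} {1F} λ ())))))
    (<-irrefl refl)
    where
    x₀ : Word (3 + m)
    x₀ = 0F ∷ 1F ∷ replicate (suc m) 1F

-- Edges by recursion on words, and weighted walks.

-- The common prefix of an edge is peeled off letter by letter, which matches the recursion of `d`
-- and avoids concatenation and casts.
data Step : ∀ {N} → Word N → Word N → ℕ → Set where
  here  : ∀ {i j e} → i ≢ j → Step (i ∷ replicate e j) (j ∷ replicate e i) e
  there : ∀ {a N} {x y : Word N} {e} → Step x y e → Step (a ∷ x) (a ∷ y) e

step : ∀ {N} {x y : Word N} (E : Edge x y) → Step x y (Edge.e E)
step (edge e s i j i≢j refl refl refl) =
  subst₂ (λ x y → Step x y e) (sym (cast-is-id refl _)) (sym (cast-is-id refl _)) (prefixed s)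
  where
  prefixed : ∀ {m} (s : Word m) → Step (s Vec.++ i ∷ replicate e j) (s Vec.++ j ∷ replicate e i) e
  prefixed []      = here i≢j
  prefixed (a ∷ s) = there (prefixed s)

∷-edge : ∀ {N} {x y : Word N} a → Edge x y → Edge (a ∷ x) (a ∷ y)
∷-edge a (edge e s i j i≢j p q r) =
  edge e (a ∷ s) i j i≢j (cong suc p) (cong (a ∷_) q) (cong (a ∷_) r)

bridge : ∀ {i j} n → i ≢ j → Edge (i ∷ replicate n j) (j ∷ replicate n i)
bridge {i} {j} n i≢j =
  edge n [] i j i≢j refl (sym (cast-is-id refl _)) (sym (cast-is-id refl _))

module WeightedWalks (ω : ℕ) where
  open Weights ω
  open Words ω

  d-cornerʳ : ∀ i {n} (w : Word n) → d w (replicate n i) ≡ corner i w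
  d-cornerʳ i {n} w = trans (d-sym w (replicate n i)) (d-cornerˡ i w)

  -- The distance to u drops by at most the weight along an edge; hence no walk is shorter than `d`.
  d-step : ∀ {N} {x y : Word N} {e} → Step x y e → ∀ u → d x u ≤ link e + d y u
  d-step (there {a} {n} {x} {y} {e} p) (h ∷ u) with a ≟ h
  ... | yes _ = d-step p u
  ... | no  _ = ≤-trans
    (⊓-mono-≤ (bound (d-step-corner h) (corner a u)) (bound (d-step-corner k) (M n + corner k u)))
    (≤-reflexive (sym (+-distribˡ-⊓ (link e) _ _)))
    where
    k = third a h
    -- A corner distance is `d` to a constant word, so the induction hypothesis covers it.
    d-step-corner : ∀ i → corner i x ≤ link e + corner i y
    d-step-corner i = subst₂ (λ p q → p ≤ link e + q) (d-cornerʳ i x) (d-cornerʳ i y)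
                        (d-step p (replicate n i))
    bound : ∀ {p q} → p ≤ link e + q → ∀ r → p + link n + r ≤ link e + (q + link n + r)
    bound {p} {q} p≤ r = ≤-trans (+-monoˡ-≤ r (+-monoˡ-≤ (link n) p≤))
                           (≤-reflexive (assoc (link e) q (link n) r))
      where
      assoc : ∀ a b c d → a + b + c + d ≡ a + (b + c + d)
      assoc = solve-∀
  d-step (here {i} {j} {n} i≢j) (h ∷ u) with h ≟ i | h ≟ j
  ... | yes refl | _ = begin
    d (i ∷ replicate n j) (i ∷ u)          ≡⟨ d-≡ i (replicate n j) u ⟩
    d (replicate n j) u                    ≡⟨ d-cornerˡ j u ⟩
    corner j u                             ≤⟨ ⊓-glb (m≤n+m _ _) detour ⟩
    (corner i v + l + corner j u) ⊓ (corner k v + l + (M n + corner k u))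
                                           ≡⟨ d-≢ v u (i≢j ∘ sym) ⟨
    d (j ∷ v) (i ∷ u)                      ≤⟨ m≤n+m _ l ⟩
    l + d (j ∷ v) (i ∷ u)                  ∎
    where
    open ≤-Reasoning
    l = link n
    v = replicate n i
    k = third j i
    detour : corner j u ≤ corner k v + l + (M n + corner k u)
    detour = ≤-trans (corner≤L j u)
      (≤-trans (L≤M n) (≤-trans (m≤m+n (M n) (corner k u)) (m≤n+m _ (corner k v + l))))
  ... | no _ | yes refl = begin
    d (i ∷ v) (j ∷ u)                      ≡⟨ d-≢ v u i≢j ⟩
    (corner j v + l + corner i u) ⊓ _      ≤⟨ m⊓n≤m _ _ ⟩
    corner j v + l + corner i u            ≡⟨ cong (λ p → p + l + corner i u)
      (corner-replicate-≡ j n) ⟩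
    l + corner i u                         ≡⟨ cong (l +_) (d-cornerˡ i u) ⟨
    l + d (replicate n i) u                ≡⟨ cong (l +_) (d-≡ j (replicate n i) u) ⟨
    l + d (j ∷ replicate n i) (j ∷ u)      ∎
    where
    open ≤-Reasoning
    l = link n
    v = replicate n j
  -- With u in the third part, the direct path from one end of the edge continues the detour from
  -- the other end.
  ... | no h≢i | no h≢j = begin
    d (i ∷ replicate n j) (h ∷ u)
      ≡⟨ d-≢ (replicate n j) u (h≢i ∘ sym) ⟩
    (corner h (replicate n j) + l + corner i u)
      ⊓ (corner (third i h) (replicate n j) + l + (M n + corner (third i h) u))
      ≡⟨ cong₂ _⊓_ (cong (λ p → p + l + corner i u) (corner-replicate-≢ n h≢j))
           (trans (cong (λ k → corner k (replicate n j) + l + (M n + corner k u)) third-i-h)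
                  (cong (λ p → p + l + (M n + corner j u)) (corner-replicate-≡ j n))) ⟩
    (M n + corner i u) ⊓ (l + (M n + corner j u))
      ≤⟨ ⊓-glb (m⊓n≤n _ _) (≤-trans (m⊓n≤m _ _) (≤-trans (m≤n+m _ l) (m≤n+m _ l))) ⟩
    (l + (M n + corner j u)) ⊓ (l + (l + (M n + corner i u)))
      ≡⟨ +-distribˡ-⊓ l _ _ ⟨
    l + ((M n + corner j u) ⊓ (l + (M n + corner i u)))
      ≡⟨ cong (l +_) (cong₂ _⊓_ (cong (λ p → p + l + corner j u) (corner-replicate-≢ n h≢i))
           (trans (cong (λ k → corner k (replicate n i) + l + (M n + corner k u)) third-j-h)
                  (cong (λ p → p + l + (M n + corner i u)) (corner-replicate-≡ i n)))) ⟨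
    l + ((corner h (replicate n i) + l + corner j u)
      ⊓ (corner (third j h) (replicate n i) + l + (M n + corner (third j h) u)))
      ≡⟨ cong (l +_) (d-≢ (replicate n i) u (h≢j ∘ sym)) ⟨
    l + d (j ∷ replicate n i) (h ∷ u) ∎
    where
    open ≤-Reasoning
    l = link n
    third-i-h : third i h ≡ j
    third-i-h = sym (third-unique i h j (h≢i ∘ sym) (i≢j ∘ sym) (h≢j ∘ sym))
    third-j-h : third j h ≡ i
    third-j-h = sym (third-unique j h i (h≢j ∘ sym) i≢j (h≢i ∘ sym))

  data WeightedWalk {N} : Word N → Word N → ℕ → Set where
    nil  : ∀ {x} → WeightedWalk x x 0
    cons : ∀ {x y z k} (E : Edge x y) → WeightedWalk y z k → WeightedWalk x z (link (Edge.e E) + k)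

  retime : ∀ {N} {x y : Word N} {k l} → k ≡ l → WeightedWalk x y k → WeightedWalk x y l
  retime refl p = p

  infixr 5 _◅◅_

  _◅◅_ : ∀ {N} {x y z : Word N} {k l} →
         WeightedWalk x y k → WeightedWalk y z l → WeightedWalk x z (k + l)
  nil ◅◅ q = q
  cons {k = k} E p ◅◅ q = retime (sym (+-assoc (link (Edge.e E)) k _)) (cons E (p ◅◅ q))

  reverse-onto : ∀ {N} {x y z : Word N} {k l} →
                 WeightedWalk x y k → WeightedWalk x z l → WeightedWalk y z (k + l)
  reverse-onto nil q = q
  reverse-onto {l = l} (cons {k = k} E p) q =
    retime (shuffle k (link (Edge.e E)) l) (reverse-onto p (cons (Edge-sym E) q))
    where
    shuffle : ∀ a b c → a + (b + c) ≡ b + a + c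
    shuffle = solve-∀

  ∷-walk : ∀ {N} a {x y : Word N} {k} → WeightedWalk x y k → WeightedWalk (a ∷ x) (a ∷ y) k
  ∷-walk a nil        = nil
  ∷-walk a (cons E p) = cons (∷-edge a E) (∷-walk a p)

  toCorner : ∀ j {n} (w : Word n) → WeightedWalk w (replicate n j) (corner j w)
  toCorner j []              = nil
  toCorner j {suc n} (a ∷ w) with j ≟ a
  ... | yes refl = ∷-walk j (toCorner j w)
  ... | no  j≢a  = retime (cong (corner j w +_)
    (trans (cong (link n +_) (corner-replicate-≢ n j≢a)) (+-comm (link n) (L n))))
    (∷-walk a (toCorner j w) ◅◅ cons (bridge n (j≢a ∘ sym)) (∷-walk j (toCorner j (replicate n a))))

  fromCorner : ∀ j {n} (w : Word n) → WeightedWalk (replicate n j) w (corner j w)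
  fromCorner j w = retime (+-identityʳ _) (reverse-onto (toCorner j w) nil)

  shortest : ∀ {n} (s t : Word n) → WeightedWalk s t (d s t)
  shortest []              []      = nil
  shortest {suc n} (i ∷ s) (j ∷ t) with i ≟ j
  ... | yes refl = ∷-walk i (shortest s t)
  ... | no  i≢j  with ⊓-sel (corner j s + link n + corner i t)
                            (corner (third i j) s + link n + (M n + corner (third i j) t))
  ...   | inj₁ eq = retime (trans (sym (+-assoc (corner j s) _ _)) (sym eq))
    (∷-walk i (toCorner j s) ◅◅ cons (bridge n i≢j) (∷-walk j (fromCorner i t)))
  ...   | inj₂ eq = retime
    (trans (cong (λ x → corner k s + (link n + (x + (link n + corner k t))))
      (corner-replicate-≢ n (i≢j ∘ sym)))
      (trans (regroup (corner k s) (link n) (L n) (corner k t)) (sym eq)))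
    (∷-walk i (toCorner k s) ◅◅ cons (bridge n (third-≢ˡ i j i≢j ∘ sym))
      (∷-walk k (toCorner j (replicate n i)) ◅◅ cons (bridge n (third-≢ʳ i j i≢j))
        (∷-walk j (fromCorner k t))))
    where
    k = third i j
    regroup : ∀ a b l c → a + (b + (l + (b + c))) ≡ a + b + (l + b + c)
    regroup = solve-∀

-- Independence of the distance function, and sums over vertex lists.

module _ (G : FiniteSimpleGraph) where
  open FiniteSimpleGraph G

  distance-unique : ∀ {d d′} → IsDistance G d → IsDistance G d′ → ∀ u v → d u v ≡ d′ u v
  distance-unique D D′ u v with p , d≤ ← D u v | p′ , d′≤ ← D′ u v = ≤-antisym (d≤ p′) (d′≤ p)

  -- `Median` brings its own distance function; by uniqueness it can be exchanged for the explicit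
  -- one.
  median⇒minimal : ∀ {d} → IsDistance G d → ∀ {v} → Median G v →
                   ∀ w → totalDistance G d v ≤ totalDistance G d w
  median⇒minimal {d} D (d′ , D′ , v≤) w = subst₂ _≤_ (total-≡ _) (total-≡ w) (v≤ w)
    where
    total-≡ : ∀ v → totalDistance G d′ v ≡ totalDistance G d v
    total-≡ v = cong sum (map-cong (distance-unique D′ D v) vertices)

sum-map-words : ∀ N (f : Word N → ℕ) → sum (map f (words N)) ≡ Σʷ N f
sum-map-words zero    f = +-identityʳ (f [])
sum-map-words (suc N) f = begin
  sum (map f (prefixed 0F ++ prefixed 1F ++ prefixed 2F ++ List.[]))
    ≡⟨ split (prefixed 0F) _ ⟩
  s (prefixed 0F) + s (prefixed 1F ++ prefixed 2F ++ List.[])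
    ≡⟨ cong (s (prefixed 0F) +_) (trans (split (prefixed 1F) _) (cong (s (prefixed 1F) +_)
         (trans (split (prefixed 2F) _) (+-identityʳ _)))) ⟩
  s (prefixed 0F) + (s (prefixed 1F) + s (prefixed 2F))
    ≡⟨ +-assoc (s (prefixed 0F)) _ _ ⟨
  s (prefixed 0F) + s (prefixed 1F) + s (prefixed 2F)
    ≡⟨ cong₂ _+_ (cong₂ _+_ (rec 0F) (rec 1F)) (rec 2F) ⟩
  Σʷ (suc N) f ∎
  where
  open ≡-Reasoning
  prefixed : T → List (Word (suc N))
  prefixed a = map (a ∷_) (words N)
  s : List (Word (suc N)) → ℕ
  s = sum ∘ map f
  split : ∀ xs ys → s (xs ++ ys) ≡ s xs + s ys
  split xs ys = trans (cong sum (map-++ f xs ys)) (sum-++ (map f xs) (map f ys))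
  rec : ∀ a → s (prefixed a) ≡ Σʷ N (f ∘ (a ∷_))
  rec a = trans (cong sum (sym (map-∘ (words N)))) (sum-map-words N (f ∘ (a ∷_)))

-- The median of the Sierpiński graph, with ω = 1.

module Sierpiński where
  open Weights 1
  open Words 1
  open WeightedWalks 1
  open Minimum 1 ≤-refl

  link≡1 : ∀ n → link n ≡ 1
  link≡1 zero    = refl
  link≡1 (suc n) = refl

  walk : ∀ {N} {x y : Word N} {k} → WeightedWalk x y k → Walk (S N) x y k
  walk nil        = nil
  walk (cons E p) rewrite link≡1 (Edge.e E) = cons E (walk p)

  d-≤-walk : ∀ {N} {x y : Word N} {k} → Walk (S N) x y k → d x y ≤ k
  d-≤-walk (nil {x})      = ≤-reflexive (d-refl x)
  d-≤-walk {y = y} (cons E p) = ≤-trans (d-step (step E) y)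
    (+-mono-≤ (≤-reflexive (link≡1 (Edge.e E))) (d-≤-walk p))

  isDistance : ∀ {N} → IsDistance (S N) d
  isDistance x y = walk (shortest x y) , d-≤-walk

  median⇒central : ∀ {m} {x : Word (3 + m)} → Median (S (3 + m)) x → Central x
  median⇒central {m} {x} med = minimal⇒central {m} λ y →
    subst₂ _≤_ (sum-map-words _ (d x)) (sum-map-words _ (d y))
      (median⇒minimal (S (3 + m)) isDistance med y)

  central⇒median : ∀ {m} {x : Word (3 + m)} → Central x → Median (S (3 + m)) x
  central⇒median {m} {x} c = d , isDistance , λ y →
    subst₂ _≤_ (sym (sum-map-words _ (d x))) (sym (sum-map-words _ (d y))) (central⇒minimal {m} c y)

-- The contraction of words to labels.

-- The inclusion of the smaller triangle graph as part a: its primitive vertex a stays primitive,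
-- and the other two are glued to the neighbouring parts.
ext : ∀ {n} → T → Label n → Label (suc n)
ext a (prim j) with a ≟ j
... | yes _ = prim j
... | no  _ = word (s≤s z≤n) (third a j ∷ [])
ext a (word p w) = word (s≤s p) (a ∷ w)

-- The vertex of Ŝ n to which a word is contracted.
label : ∀ {n} → Word (suc n) → Label n
label {zero}  (a ∷ []) = prim a
label {suc n} (a ∷ w)  = ext a (label w)

ext-≡ : ∀ {n} a → ext {n} a (prim a) ≡ prim a
ext-≡ a with a ≟ a
... | yes _   = refl
... | no  a≢a = contradiction refl a≢a

ext-≢ : ∀ {n a j} → a ≢ j → ext {n} a (prim j) ≡ word (s≤s z≤n) (third a j ∷ [])
ext-≢ {a = a} {j} a≢j with a ≟ j
... | yes a≡j = contradiction a≡j a≢j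
... | no  _   = refl

label-replicate : ∀ n i → label (replicate (suc n) i) ≡ prim i
label-replicate zero    i = refl
label-replicate (suc n) i = trans (cong (ext i) (label-replicate n i)) (ext-≡ i)

label-glued : ∀ {m n e} (s : Word m) {i j} → i ≢ j →
  (p : m + suc (suc e) ≡ suc n) → .(q : m < n) →
  label (cast p (s Vec.++ i ∷ replicate (suc e) j)) ≡ word q (s ∷ʳ third i j)
label-glued {n = zero}  [] i≢j () q
label-glued {n = suc n} {e} [] {i} {j} i≢j refl q =
  trans (cong (λ w → ext i (label w)) (cast-is-id refl (replicate (suc e) j)))
    (trans (cong (ext i) (label-replicate e j)) (ext-≢ i≢j))
label-glued {n = zero}  {e} (a ∷ s) i≢j p ()
label-glued {suc m} {suc n} {e} (a ∷ s) i≢j p q =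
  cong (ext a) (label-glued s i≢j (suc-injective p) (s<s⁻¹ q))

label-contract : ∀ {n} {x y : Word (suc n)} (E : Edge x y) (nc : IsNonClique E) →
  label x ≡ contract E nc
label-contract (edge (suc e) s i j i≢j p refl r) nc = label-glued s i≢j p (prefix-< p nc)

contractsTo⇒label : ∀ {n} {x : Word (suc n)} {v} → x ContractsTo v → label x ≡ v
contractsTo⇒label (extreme i)  = label-replicate _ i
contractsTo⇒label (glued E nc) = label-contract E nc

∷-contractsTo : ∀ {n} {x : Word (suc n)} {v} a → x ContractsTo v → (a ∷ x) ContractsTo ext a v
∷-contractsTo {n} a (extreme j) with a ≟ j
... | yes refl = extreme j
... | no  a≢j  = glued (bridge (suc n) a≢j) (s≤s z≤n)
∷-contractsTo a (glued E nc) = glued (∷-edge a E) nc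

contractsTo-label : ∀ {n} (x : Word (suc n)) → x ContractsTo label x
contractsTo-label {zero}  (a ∷ []) = extreme a
contractsTo-label {suc n} (a ∷ w)  = ∷-contractsTo a (contractsTo-label w)

label-surjective : ∀ {n} (v : Label n) → ∃[ x ] label x ≡ v
label-surjective {n} (prim i) = replicate (suc n) i , label-replicate n i
label-surjective {zero}  (word () w)
-- Any j other than k will do: the edge between the parts of j and of the third letter is contracted
-- to k.
label-surjective {suc n} (word p (k ∷ [])) with j , k≢j ← ∃≢ k =
  third k j ∷ replicate (suc n) j ,
  trans (cong (ext (third k j)) (label-replicate n j))
    (trans (ext-≢ (third-≢ʳ k j k≢j)) (cong (λ h → word (s≤s z≤n) (h ∷ []))
      (trans (third-comm (third k j) j)
        (trans (cong (third j) (third-comm k j)) (third-involutive j k (k≢j ∘ sym))))))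
label-surjective {suc n} (word p (a ∷ b ∷ w))
  with x , eq ← label-surjective {n} (word (s<s⁻¹ p) (b ∷ w)) =
  a ∷ x , cong (ext a) eq

-- Sums over labels.

sum-tabulate-+ : ∀ n (f g : Fin n → ℕ) →
  sum (tabulate (λ l → f l + g l)) ≡ sum (tabulate f) + sum (tabulate g)
sum-tabulate-+ zero    f g = refl
sum-tabulate-+ (suc n) f g =
  trans (cong (f zero + g zero +_) (sum-tabulate-+ n (f ∘ suc) (g ∘ suc)))
    (interchange (f zero) (g zero) (sum (tabulate (f ∘ suc))) (sum (tabulate (g ∘ suc))))
  where
  interchange : ∀ a b c d → a + b + (c + d) ≡ a + c + (b + d)
  interchange = solve-∀

sum-map-concat : ∀ {A : Set} (f : A → ℕ) xss →
  sum (map f (concat xss)) ≡ sum (map (sum ∘ map f) xss)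
sum-map-concat f []ₗ         = refl
sum-map-concat f (xs ∷ₗ xss) = trans (cong sum (map-++ f xs (concat xss)))
  (trans (sum-++ (map f xs) _) (cong (sum (map f xs) +_) (sum-map-concat f xss)))

-- Word labels grouped by first letter instead of by length, so that longer labels come from one
-- level below through `ext`.
Σwords : ∀ n → (Label n → ℕ) → ℕ
Σwords zero    f = 0
Σwords (suc n) f = Σ₃ (λ k → f (word (s≤s z≤n) (k ∷ []))) + Σ₃ (λ a → Σwords n (f ∘ ext a))

sum-tabulate-words : ∀ n (f : Label n → ℕ) →
  sum (tabulate (λ l → Σʷ (suc (toℕ l)) (f ∘ word (toℕ<n l)))) ≡ Σwords n f
sum-tabulate-words zero    f = refl
sum-tabulate-words (suc n) f = cong (Σ₃ (λ k → f (word (s≤s z≤n) (k ∷ []))) +_) (begin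
  sum (tabulate (λ l → s 0F l + s 1F l + s 2F l))
    ≡⟨ sum-tabulate-+ n (λ l → s 0F l + s 1F l) (s 2F) ⟩
  sum (tabulate (λ l → s 0F l + s 1F l)) + sum (tabulate (s 2F))
    ≡⟨ cong (_+ sum (tabulate (s 2F))) (sum-tabulate-+ n (s 0F) (s 1F)) ⟩
  Σ₃ (λ a → sum (tabulate (s a)))
    ≡⟨ cong₂ _+_ (cong₂ _+_ (rec 0F) (rec 1F)) (rec 2F) ⟩
  Σ₃ (λ a → Σwords n (f ∘ ext a)) ∎)
  where
  open ≡-Reasoning
  s : T → Fin n → ℕ
  s a l = Σʷ (suc (toℕ l)) (f ∘ ext a ∘ word (toℕ<n l))
  rec = λ a → sum-tabulate-words n (f ∘ ext a)

sum-map-labels : ∀ n (f : Label n → ℕ) → sum (map f (labels n)) ≡ Σ₃ (f ∘ prim) + Σwords n f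
sum-map-labels n f = begin
  f (prim 0F) + (f (prim 1F) + (f (prim 2F) + sum (map f (concat (map wordLabels (allFin n))))))
    ≡⟨ regroup (f (prim 0F)) (f (prim 1F)) (f (prim 2F)) _ ⟩
  Σ₃ (f ∘ prim) + sum (map f (concat (map wordLabels (allFin n))))
    ≡⟨ cong (Σ₃ (f ∘ prim) +_) (begin
      sum (map f (concat (map wordLabels (allFin n))))
        ≡⟨ sum-map-concat f (map wordLabels (allFin n)) ⟩
      sum (map (sum ∘ map f) (map wordLabels (allFin n)))
        ≡⟨ cong sum (map-∘ (allFin n)) ⟨
      sum (map (sum ∘ map f ∘ wordLabels) (allFin n))
        ≡⟨ cong sum (map-tabulate (λ l → l) (sum ∘ map f ∘ wordLabels)) ⟩
      sum (tabulate (sum ∘ map f ∘ wordLabels))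
        ≡⟨ cong sum (tabulate-cong pointwise) ⟩
      sum (tabulate (λ l → Σʷ (suc (toℕ l)) (f ∘ word (toℕ<n l))))
        ≡⟨ sum-tabulate-words n f ⟩
      Σwords n f ∎) ⟩
  Σ₃ (f ∘ prim) + Σwords n f ∎
  where
  open ≡-Reasoning
  regroup : ∀ a b c x → a + (b + (c + x)) ≡ a + b + c + x
  regroup = solve-∀
  pointwise : ∀ l → sum (map f (wordLabels l)) ≡ Σʷ (suc (toℕ l)) (f ∘ word (toℕ<n l))
  pointwise l = trans (cong sum (sym (map-∘ (words (suc (toℕ l))))))
    (sum-map-words (suc (toℕ l)) (f ∘ word (toℕ<n l)))

-- Every vertex of Ŝ n arises from two words, except that a primitive vertex arises from one.
2*sum-map-labels : ∀ n (f : Label n → ℕ) →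
  2 * sum (map f (labels n)) ≡ Σʷ (suc n) (f ∘ label) + Σ₃ (f ∘ prim)
2*sum-map-labels n f = trans (cong (2 *_) (sum-map-labels n f)) (go n f)
  where
  go : ∀ n (f : Label n → ℕ) →
    2 * (Σ₃ (f ∘ prim) + Σwords n f) ≡ Σʷ (suc n) (f ∘ label) + Σ₃ (f ∘ prim)
  go zero    f = rearrange (Σ₃ (f ∘ prim))
    where
    rearrange : ∀ a → 2 * (a + 0) ≡ a + a
    rearrange = solve-∀
  go (suc n) f = begin
    2 * (Σ₃ (f ∘ prim) + (Σ₃ q + Σ₃ w))
      ≡⟨ rearrange (f (prim 0F)) (f (prim 1F)) (f (prim 2F)) (q 0F) (q 1F) (q 2F) (w 0F) (w 1F)
        (w 2F) ⟩
    p 0F + 2 * w 0F + (p 1F + 2 * w 1F) + (p 2F + 2 * w 2F) + Σ₃ (f ∘ prim)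
      ≡⟨ cong (_+ Σ₃ (f ∘ prim)) (cong₂ _+_ (cong₂ _+_ (rec 0F) (rec 1F)) (rec 2F)) ⟩
    Σʷ (2 + n) (f ∘ label) + Σ₃ (f ∘ prim) ∎
    where
    open ≡-Reasoning
    p q w : T → ℕ
    p a = Σ₃ (f ∘ ext a ∘ prim)
    q k = f (word (s≤s z≤n) (k ∷ []))
    w a = Σwords n (f ∘ ext a)
    rearrange : ∀ a b c x y z u v w →
      2 * (a + b + c + (x + y + z + (u + v + w)))
      ≡ a + z + y + 2 * u + (z + b + x + 2 * v) + (y + x + c + 2 * w) + (a + b + c)
    rearrange = solve-∀
    rec : ∀ a → p a + 2 * w a ≡ Σʷ (suc n) (f ∘ ext a ∘ label)
    rec a = +-cancelʳ-≡ (p a) _ _ (trans (double (p a) (w a)) (go n (f ∘ ext a)))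
      where
      double : ∀ p w → p + 2 * w + p ≡ 2 * (p + w)
      double = solve-∀

-- Distance and median of the Sierpiński triangle graph, with ω = 0.

canon : ∀ {n} → Label n → Word (suc n)
canon v = proj₁ (label-surjective v)

label-canon : ∀ {n} (v : Label n) → label (canon v) ≡ v
label-canon v = proj₂ (label-surjective v)

module SierpińskiTriangle where
  open Weights 0
  open Words 0
  open WeightedWalks 0
  open Minimum 0 z≤n

  d-∷-cong : ∀ {n} a {x y : Word n} → (∀ u → d x u ≡ d y u) → ∀ u → d (a ∷ x) u ≡ d (a ∷ y) u
  d-∷-cong {n} a {x} {y} h (b ∷ u) with a ≟ b
  ... | yes _ = h u
  ... | no  _ = cong₂ (λ p q → (p + link n + corner a u) ⊓
    (q + link n + (M n + corner (third a b) u)))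
                      (corner-cong b) (corner-cong (third a b))
    where
    corner-cong : ∀ i → corner i x ≡ corner i y
    corner-cong i = trans (sym (d-cornerʳ i x)) (trans (h (replicate n i)) (d-cornerʳ i y))

  d-bridge : ∀ {i j} n → i ≢ j → ∀ u →
    d (i ∷ replicate (suc n) j) u ≡ d (j ∷ replicate (suc n) i) u
  d-bridge n i≢j u = ≤-antisym (d-step (here i≢j) u) (d-step (here (i≢j ∘ sym)) u)

  -- For a one-letter label the chosen preimage may be the other end of the contracted edge; that
  -- edge has weight 0, so `d-bridge` applies. For longer labels the induction passes through the
  -- first letter.
  d-canon : ∀ {n} (x : Word (suc n)) u → d (canon (label x)) u ≡ d x u
  d-canon {zero}  (a ∷ []) u = refl
  d-canon {suc n} (a ∷ x)  u with label x | contractsTo-label x | d-canon x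
  ... | word p (b ∷ w) | _ | h = d-∷-cong a h u
  ... | prim j | extreme j | _ with a ≟ j
  ...   | yes refl = refl
  ...   | no  a≢j = bridged (proj₁ (∃≢ k)) (proj₂ (∃≢ k))
    where
    k = third a j
    bridged : ∀ h → k ≢ h → d (third k h ∷ replicate (suc n) h) u ≡ d (a ∷ replicate (suc n) j) u
    bridged h k≢h with h ≟ j | h ≟ a
    ... | yes refl | _ = cong (λ b → d (b ∷ replicate (suc n) j) u)
      (trans (third-comm k j)
        (trans (cong (third j) (third-comm a j)) (third-involutive j a (a≢j ∘ sym))))
    ... | no _ | yes refl = trans
      (cong (λ b → d (b ∷ replicate (suc n) a) u)
        (trans (third-comm k a) (third-involutive a j a≢j)))
      (d-bridge n (a≢j ∘ sym) u)
    ... | no h≢j | no h≢a = contradiction (sym (third-unique a j h a≢j h≢a h≢j)) k≢h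

  d-label : ∀ {n} {x y : Word (suc n)} → label x ≡ label y → ∀ u → d x u ≡ d y u
  d-label {x = x} {y} eq u =
    trans (sym (d-canon x u)) (trans (cong (λ v → d (canon v) u) eq) (d-canon y u))

  d-clique : ∀ {N} {x y : Word N} → Step x y 0 → d x y ≡ 1
  d-clique (here i≢j) = d-≢ [] [] i≢j
  d-clique (there {a} {x = x} {y} p) = trans (d-≡ a x y) (d-clique p)

  -- Words with equal labels have distance 0 for these weights, but the ends of a clique edge have
  -- distance 1.
  label-clique-≢ : ∀ {n} {x y : Word (suc n)} → Step x y 0 → label x ≢ label y
  label-clique-≢ {x = x} {y} p eq
    with () ← trans (sym (d-clique p)) (trans (d-label eq y) (d-refl y))

  d̂ : ∀ {n} → Label n → Label n → ℕ
  d̂ u v = d (canon u) (canon v)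

  label-nonClique : ∀ {n} {x y : Word (suc n)} (E : Edge x y) → IsNonClique E → label x ≡ label y
  label-nonClique E nc = trans (label-contract E nc)
    (trans (cong (λ h → word (prefix-< (Edge.length-≡ E) nc) (Edge.s E ∷ʳ h))
      (third-comm (Edge.i E) (Edge.j E)))
      (sym (label-contract (Edge-sym E) nc)))

  walk : ∀ {n} {x y : Word (suc n)} {k} → WeightedWalk x y k → Walk (Ŝ n) (label x) (label y) k
  walk nil = nil
  walk (cons {x} {y} E@(edge zero _ _ _ _ _ _ _) p) =
    cons (label-clique-≢ (step E) , x , y , contractsTo-label x , contractsTo-label y , E , refl)
      (walk p)
  -- A non-clique edge has weight 0 and equal labels at its ends, so the step disappears.
  walk {n} (cons {z = z} {k} E@(edge (suc _) _ _ _ _ _ _ _) p) =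
    subst (λ v → Walk (Ŝ n) v (label z) k) (sym (label-nonClique E (s≤s z≤n))) (walk p)

  d̂-≤-walk : ∀ {n} {u v : Label n} {k} → Walk (Ŝ n) u v k → d̂ u v ≤ k
  d̂-≤-walk (nil {u}) = ≤-reflexive (d-refl (canon u))
  d̂-≤-walk {v = v} (cons {u} {u′} {k = k} (_ , x , y , x→u , y→u′ , E , refl) p) = begin
    d (canon u) (canon v)
      ≡⟨ d-label (trans (label-canon u) (sym (contractsTo⇒label x→u))) (canon v) ⟩
    d x (canon v)
      ≤⟨ d-step (step E) (canon v) ⟩
    1 + d y (canon v)
      ≡⟨ cong suc (d-label (trans (contractsTo⇒label y→u′) (sym (label-canon u′))) (canon v)) ⟩
    1 + d̂ u′ v
      ≤⟨ s≤s (d̂-≤-walk p) ⟩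
    suc k ∎
    where open ≤-Reasoning

  isDistance : ∀ {n} → IsDistance (Ŝ n) d̂
  isDistance {n} u v =
    subst₂ (λ a b → Walk (Ŝ n) a b (d̂ u v)) (label-canon u) (label-canon v) (walk (shortest _ _)) ,
    d̂-≤-walk

  -- Doubling counts every primitive vertex once more than its single word does. The surplus is the
  -- sum of the corner distances of x, constant by `Σ₃-corner`, so minimizing over labels and over
  -- words is the same.
  2*totalDistance : ∀ {n} (v : Label n) {x} → label x ≡ v →
    2 * totalDistance (Ŝ n) d̂ v ≡ totalᵂ x + 2 * L (suc n)
  2*totalDistance {n} v {x} eq = begin
    2 * sum (map (d̂ v) (labels n))
      ≡⟨ 2*sum-map-labels n (d̂ v) ⟩
    Σʷ (suc n) (λ w → d̂ v (label w)) + Σ₃ (λ i → d̂ v (prim i))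
      ≡⟨ cong₂ _+_ (Σʷ-cong (suc n) (λ w → trans (d-v (canon (label w)))
            (trans (d-sym x _) (trans (d-canon w x) (d-sym w x)))))
          (cong₂ _+_ (cong₂ _+_ (to-corner 0F) (to-corner 1F)) (to-corner 2F)) ⟩
    totalᵂ x + Σ₃ (λ i → corner i x)
      ≡⟨ cong (totalᵂ x +_) (Σ₃-corner x) ⟩
    totalᵂ x + 2 * L (suc n) ∎
    where
    open ≡-Reasoning
    d-v : ∀ u → d (canon v) u ≡ d x u
    d-v = d-label (trans (label-canon v) (sym eq))
    to-corner : ∀ i → d̂ v (prim i) ≡ corner i x
    to-corner i = trans (d-v (replicate (suc n) i)) (d-cornerʳ i x)

  module _ {n : ℕ} {v w : Label n} {x y : Word (suc n)}
    (x→v : label x ≡ v) (y→w : label y ≡ w) where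

    total-≤⁺ : totalᵂ x ≤ totalᵂ y → totalDistance (Ŝ n) d̂ v ≤ totalDistance (Ŝ n) d̂ w
    total-≤⁺ h = *-cancelˡ-≤ 2
      (subst₂ _≤_ (sym (2*totalDistance v x→v)) (sym (2*totalDistance w y→w))
      (+-monoˡ-≤ (2 * L (suc n)) h))

    total-≤⁻ : totalDistance (Ŝ n) d̂ v ≤ totalDistance (Ŝ n) d̂ w → totalᵂ x ≤ totalᵂ y
    total-≤⁻ h = +-cancelʳ-≤ (2 * L (suc n)) _ _
      (subst₂ _≤_ (2*totalDistance v x→v) (2*totalDistance w y→w) (2 ⊛ h))

  median⇒central : ∀ {m} {v : Label (2 + m)} → Median (Ŝ (2 + m)) v → ∃[ x ] Central x × label x ≡ v
  median⇒central {m} {v} med = canon v , minimal⇒central {m} {canon v} (λ y →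
    total-≤⁻ {x = canon v} {y} (label-canon v) refl
      (median⇒minimal (Ŝ (2 + m)) isDistance med (label y))) , label-canon v

  central⇒median : ∀ {m} {x : Word (3 + m)} → Central x → Median (Ŝ (2 + m)) (label x)
  central⇒median {m} {x} c = d̂ , isDistance , λ w →
    total-≤⁺ {x = x} {canon w} refl (label-canon w) (central⇒minimal {m} {x} c (canon w))

-- Labels and edges of the central words, and the theorem.

module _ {m : ℕ} where
  private
    n = 2 + m

  label-outer : ∀ {i j} → i ≢ j →
    label {n} (i ∷ j ∷ replicate (suc m) j) ≡ word (s≤s z≤n) (third i j ∷ [])
  label-outer {i} {j} i≢j = trans (cong (ext i) (label-replicate (suc m) j)) (ext-≢ i≢j)

  label-inner : ∀ {i j} → i ≢ j →
    label {n} (i ∷ j ∷ replicate (suc m) (third i j)) ≡ word (s≤s (s≤s z≤n)) (i ∷ i ∷ [])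
  label-inner {i} {j} i≢j = trans
    (cong (ext i) (trans (cong (ext j) (label-replicate m k)) (ext-≢ (third-≢ʳ i j i≢j ∘ sym))))
    (cong (λ h → word (s≤s (s≤s z≤n)) (i ∷ h ∷ []))
      (trans (cong (third j) (third-comm i j)) (third-involutive j i (i≢j ∘ sym))))
    where k = third i j

  central-edge : ∀ {x : Word (suc n)} → Central x →
    ∃[ y ] ∃[ E ] ∃[ nc ] (label x ≡ contract {n} {x} {y} E nc × Central y)
  central-edge (outer {i} {j} i≢j) =
    j ∷ i ∷ replicate (suc m) i , E , s≤s z≤n , label-contract E (s≤s z≤n) , outer (i≢j ∘ sym)
    where E = bridge (suc (suc m)) i≢j
  central-edge (inner {i} {j} i≢j) =
    i ∷ k ∷ replicate (suc m) j , E , s≤s z≤n , label-contract E (s≤s z≤n) , swapped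
    where
    k = third i j
    i≢k : i ≢ k
    i≢k = third-≢ˡ i j i≢j ∘ sym
    E : Edge (i ∷ j ∷ replicate (suc m) k) (i ∷ k ∷ replicate (suc m) j)
    E = ∷-edge i (bridge (suc m) (third-≢ʳ i j i≢j ∘ sym))
    swapped : Central (i ∷ k ∷ replicate (suc m) j)
    -- The third letter for i and k is j, so the other end of the edge is again of the inner form.
    swapped = subst (λ h → Central (i ∷ k ∷ replicate (suc m) h)) (third-involutive i j i≢j)
      (inner i≢k)

theorem2 : (n : ℕ) (2≤n : 2 ≤ n) →
    let 1≤n = <⇒≤ 2≤n in
    (Median (Ŝ n) ≐ (_∈ (word 1≤n (0F ∷ []) ∷ word 1≤n (1F ∷ []) ∷ word 1≤n (2F ∷ []) ∷ word 2≤n (0F ∷ 0F ∷ []) ∷ word 2≤n (1F ∷ 1F ∷ []) ∷ word 2≤n (2F ∷ 2F ∷ []) ∷ [])))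
    × HasCardinality (Median (Ŝ n)) 6
    × (Median (Ŝ n) ≐ (λ v → ∃[ x ] ∃[ y ] ∃[ E ] ∃[ nc ] (v ≡ contract {n} {x} {y} E nc × Median (S (suc n)) x × Median (S (suc n)) y)))
theorem2 (suc (suc m)) 2≤n@(s≤s (s≤s z≤n)) =
  ≐medians , (medians , medians-unique , refl , ≐medians) , median⇒edge , edge⇒median
  where
  open SierpińskiTriangle using (median⇒central; central⇒median)
  module Sierp = Sierpiński
  n = suc (suc m)
  medians = word (<⇒≤ 2≤n) (0F ∷ []) ∷ word (<⇒≤ 2≤n) (1F ∷ []) ∷ word (<⇒≤ 2≤n) (2F ∷ [])
      ∷ word 2≤n (0F ∷ 0F ∷ []) ∷ word 2≤n (1F ∷ 1F ∷ []) ∷ word 2≤n (2F ∷ 2F ∷ []) ∷ []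

  medians-unique = ((λ ()) ∷ (λ ()) ∷ (λ ()) ∷ (λ ()) ∷ (λ ()) ∷ [])
             ∷ ((λ ()) ∷ (λ ()) ∷ (λ ()) ∷ (λ ()) ∷ [])
             ∷ ((λ ()) ∷ (λ ()) ∷ (λ ()) ∷ [])
             ∷ ((λ ()) ∷ (λ ()) ∷ [])
             ∷ ((λ ()) ∷ [])
             ∷ [] ∷ []

  single∈medians : ∀ k → word (<⇒≤ 2≤n) (k ∷ []) ∈ medians
  single∈medians 0F = here refl
  single∈medians 1F = there (here refl)
  single∈medians 2F = there (there (here refl))

  double∈medians : ∀ i → word 2≤n (i ∷ i ∷ []) ∈ medians
  double∈medians 0F = there (there (there (here refl)))
  double∈medians 1F = there (there (there (there (here refl))))
  double∈medians 2F = there (there (there (there (there (here refl)))))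

  central⇒medians : ∀ {x} → Central x → label x ∈ medians
  central⇒medians (outer {i} {j} i≢j) rewrite label-outer {m} i≢j = single∈medians (third i j)
  central⇒medians (inner {i} i≢j)     rewrite label-inner {m} i≢j = double∈medians i

  outer-median : ∀ {i j} → i ≢ j → Median (Ŝ n) (word (<⇒≤ 2≤n) (third i j ∷ []))
  outer-median {i} {j} i≢j = subst (Median (Ŝ n)) (label-outer {m} i≢j)
    (central⇒median {m} {i ∷ j ∷ replicate (suc m) j} (outer i≢j))

  inner-median : ∀ {i j} → i ≢ j → Median (Ŝ n) (word 2≤n (i ∷ i ∷ []))
  inner-median {i} {j} i≢j = subst (Median (Ŝ n)) (label-inner {m} i≢j)
    (central⇒median {m} {i ∷ j ∷ replicate (suc m) (third i j)} (inner i≢j))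

  medians⇒median : ∀ {v} → v ∈ medians → Median (Ŝ n) v
  -- For a one-letter label the pair consists of the two other letters; for a doubled letter i, any
  -- second letter other than i serves.
  medians⇒median (here refl)                                 = outer-median {1F} {2F} λ ()
  medians⇒median (there (here refl))                         = outer-median {0F} {2F} λ ()
  medians⇒median (there (there (here refl)))                 = outer-median {0F} {1F} λ ()
  medians⇒median (there (there (there (here refl))))         = inner-median {0F} {1F} λ ()
  medians⇒median (there (there (there (there (here refl))))) = inner-median {1F} {0F} λ ()
  medians⇒median (there (there (there (there (there (here refl)))))) = inner-median {2F} {0F} λ ()

  median⇒medians : ∀ {v} → Median (Ŝ n) v → v ∈ medians
  median⇒medians med = go (median⇒central {m} med)
    where
    go : ∀ {v} → ∃[ x ] Central x × label x ≡ v → v ∈ medians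
    go (x , c , refl) = central⇒medians c

  ≐medians : Median (Ŝ n) ≐ (_∈ medians)
  ≐medians = median⇒medians , medians⇒median

  median⇒edge : ∀ {v} → Median (Ŝ n) v → ∃[ x ] ∃[ y ] ∃[ E ] ∃[ nc ]
    (v ≡ contract {n} {x} {y} E nc × Median (S (suc n)) x × Median (S (suc n)) y)
  median⇒edge med = go (median⇒central {m} med)
    where
    go : ∀ {v} → ∃[ x ] Central x × label x ≡ v → ∃[ x ] ∃[ y ] ∃[ E ] ∃[ nc ]
      (v ≡ contract {n} {x} {y} E nc × Median (S (suc n)) x × Median (S (suc n)) y)
    go (x , c , refl) with y , E , nc , eq , c′ ← central-edge c =
      x , y , E , nc , eq , Sierp.central⇒median {m} {x} c , Sierp.central⇒median {m} {y} c′

  edge⇒median : ∀ {v} → ∃[ x ] ∃[ y ] ∃[ E ] ∃[ nc ]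
    (v ≡ contract {n} {x} {y} E nc × Median (S (suc n)) x × Median (S (suc n)) y) → Median (Ŝ n) v
  edge⇒median (x , y , E , nc , refl , med , _) = subst (Median (Ŝ n)) (label-contract E nc)
    (central⇒median {m} {x} (Sierp.median⇒central {m} {x} med))
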